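{- Let $c$ be a circuit of $\mathsf{ACirc}$ of sort $(n,m)$, let $c'$ be a circuit with $[\![c']\!]=[\![c]\!]$ containing exactly one occurrence of $\mathsf 1$ and no occurrence of $\mathsf 1^{op}$, and let $\hat c$ be the circuit of $\mathsf{Circ}$ of sort $(n+1,m)$ obtained from $c'$ by removing this occurrence of $\mathsf 1$ and replacing it by a wire extending to a new left boundary port. Then $c$ is realisable if and only if this new port (the one to which $\mathsf 1$ was connected) is an input port of $\hat c$.
   Context: Fix a field $k$; $k(x)$ is the field of fractions of polynomials in $x$ over $k$; $\mathrm{Rat}\subseteq k(x)$ is the ring of fractions expressible with denominator having nonzero constant term. An affine map $f(p)=Ap+b$ is rational if the entries of $A$ and $b$ lie in $\mathrm{Rat}$. Circuits and sorts $(n,m)$: generators copier $\Delta:(1,2)$, discard $!:(1,0)$, adder $\mu:(2,1)$, zero $\mathsf 0:(0,1)$, one $\mathsf 1:(0,1)$, register $\mathsf x:(1,1)$, amplifier $\mathsf s_r:(1,1)$ ($r\in k$), mirror images $\Delta^{op}:(2,1)$, $!^{op}:(0,1)$, $\mu^{op}:(1,2)$, $\mathsf 0^{op}:(1,0)$, $\mathsf 1^{op}:(1,0)$, $\mathsf x^{op}:(1,1)$, $\mathsf s_r^{op}:(1,1)$, and $\mathrm{id}_0:(0,0)$, $\mathrm{id}_1:(1,1)$, $\mathrm{sw}:(2,2)$; closed under $c;d$ and $c\oplus d$. $\mathsf{ACirc}$ is the resulting free prop; $\mathsf{Circ}$ consists of circuits without $\mathsf 1,\mathsf 1^{op}$.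 Denotation $[\![c]\!]\subseteq k(x)^n\times k(x)^m$ is compositional ($;$ relational composition, $\oplus$ product) with $[\![\Delta]\!]=\{(p,(p,p))\}$, $[\![!]\!]=\{(p,\bullet)\}$, $[\![\mu]\!]=\{((p,q),p+q)\}$, $[\![\mathsf 0]\!]=\{(\bullet,0)\}$, $[\![\mathsf 1]\!]=\{(\bullet,1)\}$, $[\![\mathsf x]\!]=\{(p,xp)\}$, $[\![\mathsf s_r]\!]=\{(p,rp)\}$, mirror images denoting converse relations, $[\![\mathrm{id}_0]\!]=\{(\bullet,\bullet)\}$, $[\![\mathrm{id}_1]\!]=\{(p,p)\}$, $[\![\mathrm{sw}]\!]=\{((p,q),(q,p))\}$. Feedback: for $c:(n+1,m+1)$, $\mathrm{Tr}(c)=(\eta\oplus\mathrm{id}_n);(\mathrm{id}_1\oplus c);(\mathrm{id}_1\oplus\mathsf x\oplus\mathrm{id}_m);(\epsilon\oplus\mathrm{id}_m):(n,m)$ with $\eta=!^{op};\Delta$, $\epsilon=\Delta^{op};!$. $\mathsf{SF}$ (signal flow graphs) is the smallest class containing $\Delta,!,\mu,\mathsf 0,\mathsf x,\mathsf s_r,\mathrm{id}_0,\mathrm{id}_1,\mathrm{sw}$ closed under $;$, $\oplus$, $\mathrm{Tr}$; $\mathsf{ASF}$ is defined likewise but also containing $\mathsf 1$. Rewiring: given a partition of the ports of a circuit $d$ into $I$ (inputs) and $O$ (outputs) with orderings, the rewiring of $d$ bends, using $\eta$ and $\epsilon$, left ports in $O$ to the right and right ports in $I$ to the left; its denotation is $\{(w|_I,w|_O)\mid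 w\in[\![d]\!]\}$. For $d$ in $\mathsf{Circ}$, a port is an input port of $d$ if there is a partition with that port in $I$ whose rewiring has the same denotation as a circuit of $\mathsf{SF}$. A circuit $c$ of $\mathsf{ACirc}$ is realisable if for some partition its rewiring has the same denotation as a circuit of $\mathsf{ASF}$. -}

module Defs where

open import Level using (Level; _⊔_) renaming (suc to lsuc)
open import Algebra.Bundles using (CommutativeRing)
open import Data.Nat using (ℕ; zero; suc; _+_; _≡ᵇ_)
open import Data.Bool using (Bool; true; false; if_then_else_; not)
open import Data.Fin using (Fin; zero; suc)
open import Data.List using (List; []; _∷_; map)
open import Data.Vec using (Vec; []; _∷_; take; drop; lookup)
open import Data.Product using (Σ; ∃; ∃-syntax; _×_; _,_)
open import Data.Sum using (_⊎_; inj₁; inj₂)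
open import Data.Unit.Polymorphic using (⊤)
open import Function.Bundles using (_↔_; Inverse; _⇔_)
open import Relation.Binary.PropositionalEquality using (_≡_)
open import Relation.Nullary using (¬_)

record Field (c ℓ : Level) : Set (lsuc (c ⊔ ℓ)) where
  field
    commutativeRing : CommutativeRing c ℓ
  open CommutativeRing commutativeRing public
  field
    0≉1     : ¬ (0# ≈ 1#)
    inverse : ∀ a → ¬ (a ≈ 0#) → ∃[ b ] (a * b ≈ 1#)

module Theory {c ℓ : Level} (k : Field c ℓ) where
  open Field k using (0#; 1#) renaming (Carrier to 𝕜; _≈_ to _≈𝕜_; _+_ to _+𝕜_; _*_ to _*𝕜_)

  -- Polynomials k[x]: coefficient lists (constant term first),
  -- equal when all coefficients agree (trailing zeros irrelevant).

  Poly : Set c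
  Poly = List 𝕜

  coeff : Poly → ℕ → 𝕜
  coeff []      _       = 0#
  coeff (a ∷ p) zero    = a
  coeff (a ∷ p) (suc i) = coeff p i

  _≈ₚ_ : Poly → Poly → Set ℓ
  p ≈ₚ q = ∀ i → coeff p i ≈𝕜 coeff q i

  _+ₚ_ : Poly → Poly → Poly
  []      +ₚ q       = q
  (a ∷ p) +ₚ []      = a ∷ p
  (a ∷ p) +ₚ (b ∷ q) = (a +𝕜 b) ∷ (p +ₚ q)

  _·ₚ_ : 𝕜 → Poly → Poly
  r ·ₚ p = map (r *𝕜_) p

  _*ₚ_ : Poly → Poly → Poly
  []      *ₚ q = []
  (a ∷ p) *ₚ q = (a ·ₚ q) +ₚ (0# ∷ (p *ₚ q))

  NonZeroPoly : Poly → Set ℓ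
  NonZeroPoly q = ∃[ i ] ¬ (coeff q i ≈𝕜 0#)

  Frac : Set c
  Frac = Poly × Poly

  _≈ᶠ_ : Frac → Frac → Set ℓ
  (a , b) ≈ᶠ (a' , b') = (a *ₚ b') ≈ₚ (a' *ₚ b)

  _+ᶠ_ : Frac → Frac → Frac
  (a , b) +ᶠ (a' , b') = ((a *ₚ b') +ₚ (a' *ₚ b)) , (b *ₚ b')

  0ᶠ 1ᶠ : Frac
  0ᶠ = [] , (1# ∷ [])
  1ᶠ = (1# ∷ []) , (1# ∷ [])

  xᶠ : Frac → Frac
  xᶠ (a , b) = (0# ∷ a) , b

  sᶠ : 𝕜 → Frac → Frac
  sᶠ r (a , b) = (r ·ₚ a) , b

  record Kx : Set (c ⊔ ℓ) where
    constructor _/_∶_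
    field
      num : Poly
      den : Poly
      den≠0 : NonZeroPoly den

  ⌊_⌋ : Kx → Frac
  ⌊ a / b ∶ _ ⌋ = a , b

  _≈ₖ_ : Kx → Kx → Set ℓ
  p ≈ₖ q = ⌊ p ⌋ ≈ᶠ ⌊ q ⌋

  -- Circuits: the free prop ACirc as syntax trees.

  data ACirc : ℕ → ℕ → Set c where
    copy  : ACirc 1 2
    disc  : ACirc 1 0
    add   : ACirc 2 1
    zer   : ACirc 0 1
    one   : ACirc 0 1
    reg   : ACirc 1 1
    amp   : 𝕜 → ACirc 1 1
    copyᵒᵖ : ACirc 2 1
    discᵒᵖ : ACirc 0 1
    addᵒᵖ  : ACirc 1 2
    zerᵒᵖ  : ACirc 1 0
    oneᵒᵖ  : ACirc 1 0
    regᵒᵖ  : ACirc 1 1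
    ampᵒᵖ  : 𝕜 → ACirc 1 1
    id₀   : ACirc 0 0
    id₁   : ACirc 1 1
    sw    : ACirc 2 2
    _⨾_   : ∀ {n k m} → ACirc n k → ACirc k m → ACirc n m
    _⊕_   : ∀ {n₁ m₁ n₂ m₂} → ACirc n₁ m₁ → ACirc n₂ m₂ → ACirc (n₁ + n₂) (m₁ + m₂)

  infixl 5 _⨾_
  infixl 6 _⊕_

  idₙ : ∀ n → ACirc n n
  idₙ zero    = id₀
  idₙ (suc n) = id₁ ⊕ idₙ n

  #one #oneᵒᵖ : ∀ {n m} → ACirc n m → ℕ
  #one one     = 1
  #one (c ⨾ d) = #one c + #one d
  #one (c ⊕ d) = #one c + #one d
  #one _       = 0
  #oneᵒᵖ oneᵒᵖ   = 1
  #oneᵒᵖ (c ⨾ d) = #oneᵒᵖ c + #oneᵒᵖ d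
  #oneᵒᵖ (c ⊕ d) = #oneᵒᵖ c + #oneᵒᵖ d
  #oneᵒᵖ _       = 0

  Rel : ℕ → ℕ → Set (lsuc (c ⊔ ℓ))
  Rel n m = Vec Kx n → Vec Kx m → Set (c ⊔ ℓ)

  _≐_ : ∀ {n m} → Rel n m → Rel n m → Set (c ⊔ ℓ)
  R ≐ S = ∀ u v → (R u v → S u v) × (S u v → R u v)

  infix 4 _≐_

  _⨾ᴿ_ : ∀ {n k m} → Rel n k → Rel k m → Rel n m
  (R ⨾ᴿ S) u w = ∃[ v ] (R u v × S v w)

  _⊕ᴿ_ : ∀ {n₁ m₁ n₂ m₂} → Rel n₁ m₁ → Rel n₂ m₂ → Rel (n₁ + n₂) (m₁ + m₂)
  _⊕ᴿ_ {n₁} {m₁} R S u v = R (take n₁ u) (take m₁ v) × S (drop n₁ u) (drop m₁ v)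

  record ↑ (P : Set ℓ) : Set (c ⊔ ℓ) where
    constructor lift
    field lower : P

  ⟦copy⟧ : Rel 1 2
  ⟦copy⟧ (p ∷ []) (q ∷ r ∷ []) = ↑ (p ≈ₖ q) × ↑ (p ≈ₖ r)
  ⟦disc⟧ : Rel 1 0
  ⟦disc⟧ (p ∷ []) []          = ⊤
  ⟦add⟧ : Rel 2 1
  ⟦add⟧ (p ∷ q ∷ []) (r ∷ []) = ↑ ((⌊ p ⌋ +ᶠ ⌊ q ⌋) ≈ᶠ ⌊ r ⌋)
  ⟦zer⟧ : Rel 0 1
  ⟦zer⟧ [] (r ∷ [])           = ↑ (0ᶠ ≈ᶠ ⌊ r ⌋)
  ⟦one⟧ : Rel 0 1
  ⟦one⟧ [] (r ∷ [])           = ↑ (1ᶠ ≈ᶠ ⌊ r ⌋)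
  ⟦reg⟧ : Rel 1 1
  ⟦reg⟧ (p ∷ []) (q ∷ [])     = ↑ (xᶠ ⌊ p ⌋ ≈ᶠ ⌊ q ⌋)
  ⟦amp⟧ : 𝕜 → Rel 1 1
  ⟦amp⟧ r (p ∷ []) (q ∷ [])   = ↑ (sᶠ r ⌊ p ⌋ ≈ᶠ ⌊ q ⌋)

  ⟦_⟧ : ∀ {n m} → ACirc n m → Rel n m
  ⟦ copy ⟧ = ⟦copy⟧
  ⟦ disc ⟧ = ⟦disc⟧
  ⟦ add ⟧ = ⟦add⟧
  ⟦ zer ⟧ = ⟦zer⟧
  ⟦ one ⟧ = ⟦one⟧
  ⟦ reg ⟧ = ⟦reg⟧
  ⟦ amp r ⟧ = ⟦amp⟧ r
  ⟦ copyᵒᵖ ⟧ u v = ⟦copy⟧ v u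
  ⟦ discᵒᵖ ⟧ u v = ⟦disc⟧ v u
  ⟦ addᵒᵖ ⟧  u v = ⟦add⟧ v u
  ⟦ zerᵒᵖ ⟧  u v = ⟦zer⟧ v u
  ⟦ oneᵒᵖ ⟧  u v = ⟦one⟧ v u
  ⟦ regᵒᵖ ⟧  u v = ⟦reg⟧ v u
  ⟦ ampᵒᵖ r ⟧ u v = ⟦amp⟧ r v u
  ⟦ id₀ ⟧ [] []                 = ⊤
  ⟦ id₁ ⟧ (p ∷ []) (q ∷ [])     = ↑ (p ≈ₖ q)
  ⟦ sw ⟧ (p ∷ q ∷ []) (p' ∷ q' ∷ []) = ↑ (p ≈ₖ q') × ↑ (q ≈ₖ p')
  ⟦ c ⨾ d ⟧ = ⟦ c ⟧ ⨾ᴿ ⟦ d ⟧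
  ⟦ c ⊕ d ⟧ = ⟦ c ⟧ ⊕ᴿ ⟦ d ⟧

  η : ACirc 0 2
  η = discᵒᵖ ⨾ copy

  ε : ACirc 2 0
  ε = copyᵒᵖ ⨾ disc

  Tr : ∀ {n m} → ACirc (suc n) (suc m) → ACirc n m
  Tr {n} {m} c = (η ⊕ idₙ n) ⨾ (id₁ ⊕ c) ⨾ (id₁ ⊕ reg ⊕ idₙ m) ⨾ (ε ⊕ idₙ m)

  data IsSF : Bool → ∀ {n m} → ACirc n m → Set c where
    copy : ∀ {b} → IsSF b copy
    disc : ∀ {b} → IsSF b disc
    add  : ∀ {b} → IsSF b add
    zer  : ∀ {b} → IsSF b zer
    one  : IsSF true one
    reg  : ∀ {b} → IsSF b reg
    amp  : ∀ {b} r → IsSF b (amp r)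
    id₀  : ∀ {b} → IsSF b id₀
    id₁  : ∀ {b} → IsSF b id₁
    sw   : ∀ {b} → IsSF b sw
    seq  : ∀ {b n k m} {c : ACirc n k} {d : ACirc k m} →
           IsSF b c → IsSF b d → IsSF b (c ⨾ d)
    par  : ∀ {b n₁ m₁ n₂ m₂} {c : ACirc n₁ m₁} {d : ACirc n₂ m₂} →
           IsSF b c → IsSF b d → IsSF b (c ⊕ d)
    tr   : ∀ {b n m} {c : ACirc (suc n) (suc m)} →
           IsSF b c → IsSF b (Tr c)

  SF ASF : ∀ {n m} → ACirc n m → Set c
  SF  = IsSF false
  ASF = IsSF true

  Port : ℕ → ℕ → Set
  Port n m = Fin n ⊎ Fin m

  -- a partition of the ports into inputs I (|I| = i) and outputs O
  -- (|O| = o), each with an ordering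
  Partition : ℕ → ℕ → ℕ → ℕ → Set
  Partition n m i o = (Fin i ⊎ Fin o) ↔ Port n m

  at : ∀ {n m} → Vec Kx n → Vec Kx m → Port n m → Kx
  at u v (inj₁ j) = lookup u j
  at u v (inj₂ j) = lookup v j

  rewire : ∀ {n m i o} → ACirc n m → Partition n m i o → Rel i o
  rewire d σ u' v' =
    ∃[ u ] ∃[ v ] (⟦ d ⟧ u v
      × (∀ j → ↑ (lookup u' j ≈ₖ at u v (Inverse.to σ (inj₁ j))))
      × (∀ j → ↑ (lookup v' j ≈ₖ at u v (Inverse.to σ (inj₂ j)))))

  IsInputPort : ∀ {n m} → ACirc n m → Port n m → Set (c ⊔ ℓ)
  IsInputPort {n} {m} d p =
    ∃[ i ] ∃[ o ] Σ (Partition n m i o) λ σ →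
      (∃[ j ] Inverse.to σ (inj₁ j) ≡ p)
      × ∃[ e ] (SF {i} {o} e × (⟦ e ⟧ ≐ rewire d σ))

  Realisable : ∀ {n m} → ACirc n m → Set (c ⊔ ℓ)
  Realisable {n} {m} d =
    ∃[ i ] ∃[ o ] Σ (Partition n m i o) λ σ →
      ∃[ e ] (ASF {i} {o} e × (⟦ e ⟧ ≐ rewire d σ))

  -- Removing the (unique) occurrence of 1 and replacing it by a wire to
  -- a new left boundary port, which becomes left port 0.

  shift : ∀ n k → ACirc (suc (n + k)) (n + suc k)
  shift zero    k = idₙ (suc k)
  shift (suc n) k = (sw ⊕ idₙ (n + k)) ⨾ (id₁ ⊕ shift n k)

  has1 : ∀ {n m} → ACirc n m → Bool
  has1 c = not (#one c ≡ᵇ 0)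

  -- hat c is only meaningful when c has exactly one occurrence of 1;
  -- on subcircuits without 1 it returns the (irrelevant) disc ⊕ c.
  hat : ∀ {n m} → ACirc n m → ACirc (suc n) m
  hat one = id₁
  hat {n} (_⨾_ {k = k} c d) =
    if has1 c then hat c ⨾ d else ((id₁ ⊕ c) ⨾ hat d)
  hat (_⊕_ {n₁} {m₁} {n₂} c d) =
    if has1 c then hat c ⊕ d else (shift n₁ n₂ ⨾ (c ⊕ hat d))
  hat c = disc ⊕ c

{-# OPTIONS --safe #-}
-- A circuit containing 1 denotes the slice t = 1 of a linear relation on (t , u , v) in which every
-- occurrence of 1 is replaced by the wire t. If c is realised by a signal flow graph e with 1, then
-- replacing the occurrences of 1 in e by an input t gives a signal flow graph whose relation is linear
-- and has the same slice t = 1 as the rewired ĉ. This slice is nonempty, because signal flow graphs are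
-- total on Rat, and a linear relation is determined by a nonempty slice t = 1. Hence the two relations
-- agree and t is an input port. Conversely, plugging 1 into an input port realises c.
--
-- Equality in k is not assumed to be decidable, so a product of nonzero polynomials need not have a
-- coefficient that is known to be nonzero. Denominators are therefore taken to be the polynomials whose
-- coefficients generate the unit ideal; these are closed under products and regular by McCoy's theorem.
module Submission where

open import Defs
open import Level using (_⊔_)
open import Algebra.Bundles using (CommutativeRing)
open import Algebra.Morphism.Structures using (IsRingMonomorphism)
import Algebra.Morphism.RingMonomorphism as RingMonomorphism
import Algebra.Properties.Ring
import Algebra.Solver.Ring.NaturalCoefficients.Default as SemiringSolver
open import Algebra.Structures using (IsCommutativeRing)
open import Data.Bool using (true; false)
open import Data.Empty.Polymorphic using (⊥)
open import Data.Fin using (Fin; zero; suc; punchIn; punchOut; _≟_)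
import Data.Fin.Properties as Fin
open import Data.List using ([]; _∷_)
open import Data.Nat using (ℕ; zero; suc) renaming (_+_ to _+ℕ_)
import Data.Nat.Properties as ℕ
open import Data.Product using (∃-syntax; _×_; _,_; proj₁; proj₂)
open import Data.Sum using (_⊎_; inj₁; inj₂)
open import Data.Sum.Properties using (inj₁-injective)
open import Data.Unit.Polymorphic using (⊤; tt)
open import Data.Vec using (Vec; []; _∷_; _++_; take; drop; lookup; zipWith; insertAt; replicate)
import Data.Vec.Properties as Vec
open import Data.Vec.Relation.Binary.Pointwise.Inductive as Pointwise using (Pointwise; []; _∷_)
open import Data.Vec.Relation.Unary.All using (All; []; _∷_)
import Data.Vec.Relation.Unary.All.Properties as All
open import Function.Bundles using (_⇔_; mk⇔; Equivalence; Inverse; mk↔ₛ′)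
import Relation.Binary.PropositionalEquality as ≡
open ≡ using (_≡_; _≢_)
import Relation.Binary.Reasoning.Setoid as SetoidReasoning
open import Relation.Nullary using (yes; no; contradiction)

-- The commutative ring of polynomials.

module Polynomials {c ℓ} (k : Field c ℓ) where
  open Theory k using (Poly; coeff; _≈ₚ_; NonZeroPoly)
    renaming (_+ₚ_ to infixl 6 _+ₚ_; _*ₚ_ to infixl 7 _*ₚ_; _·ₚ_ to infixr 8 _·ₚ_)
  open Field k
  open SemiringSolver commutativeSemiring using (solve; _:=_; _:+_)
  private module R = Algebra.Properties.Ring ring

  -- Wrapped in a record, so that p and q can be inferred from a proof.
  infix 4 _≋_
  record _≋_ (p q : Poly) : Set ℓ where
    constructor pointwise
    field coeffs : p ≈ₚ q
  open _≋_ public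

  coeff-+ : ∀ p q i → coeff (p +ₚ q) i ≈ coeff p i + coeff q i
  coeff-+ []      q       i       = sym (+-identityˡ _)
  coeff-+ (a ∷ p) []      i       = sym (+-identityʳ _)
  coeff-+ (a ∷ p) (b ∷ q) zero    = refl
  coeff-+ (a ∷ p) (b ∷ q) (suc i) = coeff-+ p q i

  coeff-· : ∀ r p i → coeff (r ·ₚ p) i ≈ r * coeff p i
  coeff-· r []      i       = sym (zeroʳ r)
  coeff-· r (a ∷ p) zero    = refl
  coeff-· r (a ∷ p) (suc i) = coeff-· r p i

  negₚ : Poly → Poly
  negₚ p = (- 1#) ·ₚ p

  ≋-refl : ∀ {p} → p ≋ p
  ≋-refl = pointwise λ i → refl

  ≋-sym : ∀ {p q} → p ≋ q → q ≋ p
  ≋-sym (pointwise e) = pointwise λ i → sym (e i)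

  ≋-trans : ∀ {p q r} → p ≋ q → q ≋ r → p ≋ r
  ≋-trans (pointwise e) (pointwise f) = pointwise λ i → trans (e i) (f i)

  ∷-cong : ∀ {a b p q} → a ≈ b → p ≋ q → a ∷ p ≋ b ∷ q
  ∷-cong a≈b (pointwise e) = pointwise λ { zero → a≈b ; (suc i) → e i }

  tail-≋ : ∀ {a b p q} → a ∷ p ≋ b ∷ q → p ≋ q
  tail-≋ (pointwise e) = pointwise λ i → e (suc i)

  tail-≋-[] : ∀ {a p} → a ∷ p ≋ [] → p ≋ []
  tail-≋-[] (pointwise e) = pointwise λ i → e (suc i)

  ∷≋[] : ∀ {a p} → a ≈ 0# → p ≋ [] → a ∷ p ≋ []
  ∷≋[] a≈0 (pointwise e) = pointwise λ { zero → a≈0 ; (suc i) → e i }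

  +ₚ-cong : ∀ {p p′ q q′} → p ≋ p′ → q ≋ q′ → p +ₚ q ≋ p′ +ₚ q′
  +ₚ-cong {p} {p′} {q} {q′} (pointwise e) (pointwise f) = pointwise λ i →
    trans (coeff-+ p q i) (trans (+-cong (e i) (f i)) (sym (coeff-+ p′ q′ i)))

  ·ₚ-cong : ∀ {r s p q} → r ≈ s → p ≋ q → r ·ₚ p ≋ s ·ₚ q
  ·ₚ-cong {r} {s} {p} {q} r≈s (pointwise e) = pointwise λ i →
    trans (coeff-· r p i) (trans (*-cong r≈s (e i)) (sym (coeff-· s q i)))

  +ₚ-assoc : ∀ p q r → (p +ₚ q) +ₚ r ≋ p +ₚ (q +ₚ r)
  +ₚ-assoc p q r = pointwise λ i → begin
    coeff ((p +ₚ q) +ₚ r) i                ≈⟨ coeff-+ (p +ₚ q) r i ⟩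
    coeff (p +ₚ q) i + coeff r i           ≈⟨ +-congʳ (coeff-+ p q i) ⟩
    (coeff p i + coeff q i) + coeff r i    ≈⟨ +-assoc _ _ _ ⟩
    coeff p i + (coeff q i + coeff r i)    ≈⟨ +-congˡ (coeff-+ q r i) ⟨
    coeff p i + coeff (q +ₚ r) i           ≈⟨ coeff-+ p (q +ₚ r) i ⟨
    coeff (p +ₚ (q +ₚ r)) i                ∎
    where open SetoidReasoning setoid

  +ₚ-comm : ∀ p q → p +ₚ q ≋ q +ₚ p
  +ₚ-comm p q = pointwise λ i →
    trans (coeff-+ p q i) (trans (+-comm _ _) (sym (coeff-+ q p i)))

  +ₚ-identityʳ : ∀ p → p +ₚ [] ≋ p
  +ₚ-identityʳ []      = ≋-refl
  +ₚ-identityʳ (a ∷ p) = ≋-refl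

  +ₚ-inverseˡ : ∀ p → negₚ p +ₚ p ≋ []
  +ₚ-inverseˡ p = pointwise λ i → begin
    coeff (negₚ p +ₚ p) i             ≈⟨ coeff-+ (negₚ p) p i ⟩
    coeff (negₚ p) i + coeff p i      ≈⟨ +-congʳ (coeff-· _ p i) ⟩
    (- 1#) * coeff p i + coeff p i    ≈⟨ +-congʳ (R.-1*x≈-x _) ⟩
    - coeff p i + coeff p i           ≈⟨ -‿inverseˡ _ ⟩
    0#                                ∎
    where open SetoidReasoning setoid

  ·ₚ-distribˡ : ∀ r p q → r ·ₚ (p +ₚ q) ≋ r ·ₚ p +ₚ r ·ₚ q
  ·ₚ-distribˡ r []      q       = ≋-refl
  ·ₚ-distribˡ r (a ∷ p) []      = ≋-refl
  ·ₚ-distribˡ r (a ∷ p) (b ∷ q) = ∷-cong (distribˡ _ _ _) (·ₚ-distribˡ r p q)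

  ·ₚ-distribʳ : ∀ p r s → (r + s) ·ₚ p ≋ r ·ₚ p +ₚ s ·ₚ p
  ·ₚ-distribʳ []      r s = ≋-refl
  ·ₚ-distribʳ (a ∷ p) r s = ∷-cong (distribʳ _ _ _) (·ₚ-distribʳ p r s)

  ·ₚ-assoc : ∀ r s p → (r * s) ·ₚ p ≋ r ·ₚ (s ·ₚ p)
  ·ₚ-assoc r s []      = ≋-refl
  ·ₚ-assoc r s (a ∷ p) = ∷-cong (*-assoc _ _ _) (·ₚ-assoc r s p)

  ·ₚ-zeroˡ : ∀ {r} p → r ≈ 0# → r ·ₚ p ≋ []
  ·ₚ-zeroˡ []      r≈0 = ≋-refl
  ·ₚ-zeroˡ (a ∷ p) r≈0 = ∷≋[] (trans (*-congʳ r≈0) (zeroˡ a)) (·ₚ-zeroˡ p r≈0)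

  ·ₚ-identity : ∀ p → 1# ·ₚ p ≋ p
  ·ₚ-identity []      = ≋-refl
  ·ₚ-identity (a ∷ p) = ∷-cong (*-identityˡ a) (·ₚ-identity p)

  *ₚ-zeroˡ : ∀ {p} q → p ≋ [] → p *ₚ q ≋ []
  *ₚ-zeroˡ {[]}    q e = ≋-refl
  *ₚ-zeroˡ {a ∷ p} q e =
    +ₚ-cong (·ₚ-zeroˡ q (coeffs e 0)) (∷≋[] refl (*ₚ-zeroˡ q (tail-≋-[] e)))

  *ₚ-zeroʳ : ∀ p → p *ₚ [] ≋ []
  *ₚ-zeroʳ []      = ≋-refl
  *ₚ-zeroʳ (a ∷ p) = ∷≋[] refl (*ₚ-zeroʳ p)

  *ₚ-congˡ : ∀ p {q q′} → q ≋ q′ → p *ₚ q ≋ p *ₚ q′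
  *ₚ-congˡ []      e = ≋-refl
  *ₚ-congˡ (a ∷ p) e = +ₚ-cong (·ₚ-cong refl e) (∷-cong refl (*ₚ-congˡ p e))

  *ₚ-congʳ : ∀ {p p′} q → p ≋ p′ → p *ₚ q ≋ p′ *ₚ q
  *ₚ-congʳ {[]}    {p′}     q e = ≋-sym (*ₚ-zeroˡ q (≋-sym e))
  *ₚ-congʳ {a ∷ p} {[]}     q e = *ₚ-zeroˡ q e
  *ₚ-congʳ {a ∷ p} {b ∷ p′} q e =
    +ₚ-cong (·ₚ-cong (coeffs e 0) ≋-refl) (∷-cong refl (*ₚ-congʳ q (tail-≋ e)))

  0∷-*ₚ : ∀ p q → (0# ∷ p) *ₚ q ≋ 0# ∷ (p *ₚ q)
  0∷-*ₚ p q = +ₚ-cong (·ₚ-zeroˡ q refl) ≋-refl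

  +ₚ-interchange : ∀ p q r s → (p +ₚ q) +ₚ (r +ₚ s) ≋ (p +ₚ r) +ₚ (q +ₚ s)
  +ₚ-interchange p q r s = pointwise λ i →
    trans (expand p q r s i)
      (trans (solve 4 (λ a b d e → (a :+ b) :+ (d :+ e) := (a :+ d) :+ (b :+ e)) refl
               (coeff p i) (coeff q i) (coeff r i) (coeff s i))
        (sym (expand p r q s i)))
    where
    expand : ∀ p q r s i →
      coeff ((p +ₚ q) +ₚ (r +ₚ s)) i ≈ (coeff p i + coeff q i) + (coeff r i + coeff s i)
    expand p q r s i =
      trans (coeff-+ (p +ₚ q) (r +ₚ s) i) (+-cong (coeff-+ p q i) (coeff-+ r s i))

  0∷-+ₚ : ∀ p q → 0# ∷ (p +ₚ q) ≋ (0# ∷ p) +ₚ (0# ∷ q)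
  0∷-+ₚ p q = ∷-cong (sym (+-identityˡ 0#)) ≋-refl

  *ₚ-distribʳ : ∀ q p p′ → (p +ₚ p′) *ₚ q ≋ p *ₚ q +ₚ p′ *ₚ q
  *ₚ-distribʳ q []      p′       = ≋-refl
  *ₚ-distribʳ q (a ∷ p) []       = ≋-sym (+ₚ-identityʳ _)
  *ₚ-distribʳ q (a ∷ p) (b ∷ p′) =
    ≋-trans
      (+ₚ-cong (·ₚ-distribʳ q a b)
        (≋-trans (∷-cong refl (*ₚ-distribʳ q p p′)) (0∷-+ₚ (p *ₚ q) (p′ *ₚ q))))
      (+ₚ-interchange (a ·ₚ q) (b ·ₚ q) (0# ∷ (p *ₚ q)) (0# ∷ (p′ *ₚ q)))

  ·ₚ-*ₚ : ∀ r p q → (r ·ₚ p) *ₚ q ≋ r ·ₚ (p *ₚ q)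
  ·ₚ-*ₚ r []      q = ≋-refl
  ·ₚ-*ₚ r (a ∷ p) q =
    ≋-trans
      (+ₚ-cong (·ₚ-assoc r a q) (∷-cong (sym (zeroʳ r)) (·ₚ-*ₚ r p q)))
      (≋-sym (·ₚ-distribˡ r (a ·ₚ q) (0# ∷ (p *ₚ q))))

  *ₚ-assoc : ∀ p q s → (p *ₚ q) *ₚ s ≋ p *ₚ (q *ₚ s)
  *ₚ-assoc []      q s = ≋-refl
  *ₚ-assoc (a ∷ p) q s =
    ≋-trans (*ₚ-distribʳ s (a ·ₚ q) (0# ∷ (p *ₚ q)))
      (+ₚ-cong (·ₚ-*ₚ a q s)
        (≋-trans (0∷-*ₚ (p *ₚ q) s) (∷-cong refl (*ₚ-assoc p q s))))

  -- `*ₚ` recurses on its left factor; the induction for commutativity also has to unfold the right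
  -- one.
  *ₚ-∷ : ∀ q a p → q *ₚ (a ∷ p) ≋ a ·ₚ q +ₚ (0# ∷ (q *ₚ p))
  *ₚ-∷ []      a p = ≋-sym (∷≋[] refl ≋-refl)
  *ₚ-∷ (b ∷ q) a p = ∷-cong (+-congʳ (*-comm b a))
    (≋-trans (+ₚ-cong ≋-refl (*ₚ-∷ q a p))
      (≋-trans (≋-sym (+ₚ-assoc (b ·ₚ p) (a ·ₚ q) (0# ∷ (q *ₚ p))))
        (≋-trans (+ₚ-cong (+ₚ-comm (b ·ₚ p) (a ·ₚ q)) ≋-refl)
          (+ₚ-assoc (a ·ₚ q) (b ·ₚ p) (0# ∷ (q *ₚ p))))))

  *ₚ-comm : ∀ p q → p *ₚ q ≋ q *ₚ p
  *ₚ-comm []      q = ≋-sym (*ₚ-zeroʳ q)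
  *ₚ-comm (a ∷ p) q =
    ≋-trans (+ₚ-cong ≋-refl (∷-cong refl (*ₚ-comm p q))) (≋-sym (*ₚ-∷ q a p))

  [_]ₚ : Carrier → Poly
  [ r ]ₚ = r ∷ []

  []ₚ-*ₚ : ∀ r p → [ r ]ₚ *ₚ p ≋ r ·ₚ p
  []ₚ-*ₚ r p = ≋-trans (+ₚ-cong ≋-refl (∷≋[] refl ≋-refl)) (+ₚ-identityʳ _)

  *ₚ-identityˡ : ∀ p → [ 1# ]ₚ *ₚ p ≋ p
  *ₚ-identityˡ p = ≋-trans ([]ₚ-*ₚ 1# p) (·ₚ-identity p)

  polyRing : CommutativeRing c ℓ
  polyRing = record
    { Carrier = Poly
    ; _≈_ = _≋_
    ; _+_ = _+ₚ_
    ; _*_ = _*ₚ_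
    ; -_ = negₚ
    ; 0# = []
    ; 1# = [ 1# ]ₚ
    ; isCommutativeRing = record
      { isRing = record
        { +-isAbelianGroup = record
          { isGroup = record
            { isMonoid = record
              { isSemigroup = record
                { isMagma = record
                  { isEquivalence = record
                    { refl = ≋-refl ; sym = ≋-sym ; trans = ≋-trans }
                  ; ∙-cong = +ₚ-cong
                  }
                ; assoc = +ₚ-assoc
                }
              ; identity = (λ p → ≋-refl) , +ₚ-identityʳ
              }
            ; inverse = +ₚ-inverseˡ , λ p → ≋-trans (+ₚ-comm p (negₚ p)) (+ₚ-inverseˡ p)
            ; ⁻¹-cong = ·ₚ-cong refl
            }
          ; comm = +ₚ-comm
          }
        ; *-cong = λ {p} {p′} {q} {q′} e f → ≋-trans (*ₚ-congʳ q e) (*ₚ-congˡ p′ f)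
        ; *-assoc = *ₚ-assoc
        ; *-identity = *ₚ-identityˡ , λ p → ≋-trans (*ₚ-comm p [ 1# ]ₚ) (*ₚ-identityˡ p)
        ; distrib =
            (λ p q r → ≋-trans (*ₚ-comm p (q +ₚ r))
              (≋-trans (*ₚ-distribʳ p q r) (+ₚ-cong (*ₚ-comm q p) (*ₚ-comm r p))))
            , *ₚ-distribʳ
        }
      ; *-comm = *ₚ-comm
      }
    }

  -- Ideals of `k`, McCoy's theorem and unimodular polynomials.

  record IsIdeal {j} (J : Carrier → Set j) : Set (c ⊔ ℓ ⊔ j) where
    field
      resp : ∀ {a b} → a ≈ b → J a → J b
      zero∈ : J 0#
      +-closed : ∀ {a b} → J a → J b → J (a + b)
      *-closed : ∀ r {a} → J a → J (r * a)

  -- Membership in `J` stands in for vanishing in `k/J`, so no quotient ring is built. Classically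
  -- an ideal of a field is zero or everything, but which of the two holds need not be decidable.
  -- The zero ideal will give regularity, a content ideal closure under products.
  module Unimodular {j} {J : Carrier → Set j} (isIdeal : IsIdeal J) where
    open IsIdeal isIdeal

    -- p ∈ J[x]
    AllIn : Poly → Set j
    AllIn p = ∀ i → J (coeff p i)

    allIn-resp : ∀ {p q} → p ≋ q → AllIn p → AllIn q
    allIn-resp e p∈ i = resp (coeffs e i) (p∈ i)

    allIn-· : ∀ r p → AllIn p → AllIn (r ·ₚ p)
    allIn-· r p p∈ i = resp (sym (coeff-· r p i)) (*-closed r (p∈ i))

    allIn-·-head : ∀ {a} p → J a → AllIn (a ·ₚ p)
    allIn-·-head {a} p a∈ i =
      resp (trans (*-comm _ _) (sym (coeff-· a p i))) (*-closed (coeff p i) a∈)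

    allIn-cancel : ∀ p q → AllIn p → AllIn (p +ₚ q) → AllIn q
    allIn-cancel p q p∈ pq∈ i = resp eq (+-closed (*-closed (- 1#) (p∈ i)) (pq∈ i))
      where
      eq : (- 1#) * coeff p i + coeff (p +ₚ q) i ≈ coeff q i
      eq = begin
        (- 1#) * coeff p i + coeff (p +ₚ q) i          ≈⟨ +-cong (R.-1*x≈-x _) (coeff-+ p q i) ⟩
        - coeff p i + (coeff p i + coeff q i)          ≈⟨ +-assoc _ _ _ ⟨
        (- coeff p i + coeff p i) + coeff q i          ≈⟨ +-congʳ (-‿inverseˡ _) ⟩
        0# + coeff q i                                 ≈⟨ +-identityˡ _ ⟩
        coeff q i                                      ∎
        where open SetoidReasoning setoid

    allIn-tail : ∀ a p → AllIn (a ∷ p) → AllIn p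
    allIn-tail a p ap∈ i = ap∈ (suc i)

    coeff₀-* : ∀ b₀ b g₀ g → coeff ((b₀ ∷ b) *ₚ (g₀ ∷ g)) 0 ≈ b₀ * g₀
    coeff₀-* b₀ b g₀ g = +-identityʳ _

    -- Regularity of the class of `b` in `(k/J)[x]`.
    Cancels : Poly → Set (c ⊔ j)
    Cancels b = ∀ g → AllIn (b *ₚ g) → AllIn g

    *ₚ-·ₚ : ∀ p r q → p *ₚ (r ·ₚ q) ≋ r ·ₚ (p *ₚ q)
    *ₚ-·ₚ p r q = ≋-trans (*ₚ-comm p (r ·ₚ q)) (≋-trans (·ₚ-*ₚ r q p) (·ₚ-cong refl (*ₚ-comm q p)))

    -- Comparing lowest coefficients shows that b₀g ∈ J[x] by induction on g.
    -- The induction is on all multiples r·g, since b₀ gets multiplied in.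
    cancels-∷ : ∀ b₀ b → (∀ g → AllIn (b₀ ·ₚ g) → AllIn (b *ₚ g) → AllIn g) → Cancels (b₀ ∷ b)
    cancels-∷ b₀ b step g bg∈ =
      allIn-resp (·ₚ-identity g)
        (multiples g 1# (allIn-resp (*ₚ-congˡ (b₀ ∷ b) (≋-sym (·ₚ-identity g))) bg∈))
      where
      multiples : ∀ g r → AllIn ((b₀ ∷ b) *ₚ (r ·ₚ g)) → AllIn (r ·ₚ g)
      multiples []       r h∈ i = zero∈
      multiples (g₀ ∷ g) r h∈ = step (r ·ₚ (g₀ ∷ g)) b₀h∈ bh∈
        where
        head∈ : J (b₀ * (r * g₀))
        head∈ = resp (coeff₀-* b₀ b (r * g₀) (r ·ₚ g)) (h∈ 0)

        -- This splits off the lowest coefficient of `r ·ₚ (g₀ ∷ g)`. The first summand lies in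
        -- `J[x]` by `head∈`, hence so does the second, which is a shifted instance of the
        -- hypothesis for the shorter `g` with multiplier `b₀ * r`.
        shifted : b₀ ·ₚ ((b₀ ∷ b) *ₚ (r ·ₚ (g₀ ∷ g)))
                  ≋ (b₀ * (r * g₀)) ·ₚ (b₀ ∷ b) +ₚ (0# ∷ ((b₀ ∷ b) *ₚ ((b₀ * r) ·ₚ g)))
        shifted =
          ≋-trans (≋-sym (*ₚ-·ₚ (b₀ ∷ b) b₀ (r ·ₚ (g₀ ∷ g))))
            (≋-trans (*ₚ-congˡ (b₀ ∷ b) (∷-cong refl (≋-sym (·ₚ-assoc b₀ r g))))
              (*ₚ-∷ (b₀ ∷ b) (b₀ * (r * g₀)) ((b₀ * r) ·ₚ g)))

        tail∈ : AllIn ((b₀ * r) ·ₚ g)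
        tail∈ = multiples g (b₀ * r)
          (allIn-tail 0# ((b₀ ∷ b) *ₚ ((b₀ * r) ·ₚ g))
            (allIn-cancel ((b₀ * (r * g₀)) ·ₚ (b₀ ∷ b)) (0# ∷ ((b₀ ∷ b) *ₚ ((b₀ * r) ·ₚ g)))
              (allIn-·-head (b₀ ∷ b) head∈)
              (allIn-resp shifted (allIn-· b₀ ((b₀ ∷ b) *ₚ (r ·ₚ (g₀ ∷ g))) h∈))))

        b₀h∈ : AllIn (b₀ ·ₚ (r ·ₚ (g₀ ∷ g)))
        b₀h∈ zero    = head∈
        b₀h∈ (suc i) = resp (coeffs (·ₚ-assoc b₀ r g) i) (tail∈ i)

        bh∈ : AllIn (b *ₚ (r ·ₚ (g₀ ∷ g)))
        bh∈ = allIn-tail 0# (b *ₚ (r ·ₚ (g₀ ∷ g)))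
          (allIn-cancel (b₀ ·ₚ (r ·ₚ (g₀ ∷ g))) (0# ∷ (b *ₚ (r ·ₚ (g₀ ∷ g)))) b₀h∈ h∈)

    -- McCoy's theorem over k/J.
    mccoy : ∀ b i → coeff b i ≈ 1# → Cancels b
    mccoy []       i       0≈1  = contradiction 0≈1 0≉1
    mccoy (b₀ ∷ b) zero    b₀≈1 = cancels-∷ b₀ b λ g b₀g∈ _ →
      allIn-resp (≋-trans (·ₚ-cong b₀≈1 ≋-refl) (·ₚ-identity g)) b₀g∈
    mccoy (b₀ ∷ b) (suc i) bᵢ≈1 = cancels-∷ b₀ b λ g _ → mccoy b i bᵢ≈1 g

  zeroIdeal : IsIdeal (_≈ 0#)
  zeroIdeal = record
    { resp = λ a≈b a≈0 → trans (sym a≈b) a≈0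
    ; zero∈ = refl
    ; +-closed = λ a≈0 b≈0 → trans (+-cong a≈0 b≈0) (+-identityˡ 0#)
    ; *-closed = λ r a≈0 → trans (*-congˡ a≈0) (zeroʳ r)
    }

  -- The ideal generated by the coefficients of `f`. A linear combination of them is a single
  -- coefficient of a product `h *ₚ f`, where `h` lists the multipliers in reverse order; this
  -- avoids explicit sums.
  Content : Poly → Carrier → Set (c ⊔ ℓ)
  Content f a = ∃[ h ] ∃[ i ] (coeff (h *ₚ f) i ≈ a)

  -- Multiplying `h` by the variable moves the coefficient up by one. Two elements of the content
  -- are thereby read off at a common index, where they can be added.
  content-raise : ∀ f j i {h a} → coeff (h *ₚ f) i ≈ a → ∃[ h′ ] (coeff (h′ *ₚ f) (j +ℕ i) ≈ a)
  content-raise f zero    i {h} e = h , e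
  content-raise f (suc j) i {h} e with content-raise f j i {h} e
  ... | h′ , e′ = 0# ∷ h′ , trans (coeffs (0∷-*ₚ h′ f) (suc (j +ℕ i))) e′

  contentIdeal : ∀ f → IsIdeal (Content f)
  contentIdeal f = record
    { resp = λ a≈b (h , i , e) → h , i , trans e a≈b
    ; zero∈ = [] , 0 , refl
    ; +-closed = add
    ; *-closed = λ r (h , i , e) →
        r ·ₚ h , i , trans (coeffs (·ₚ-*ₚ r h f) i) (trans (coeff-· r (h *ₚ f) i) (*-congˡ e))
    }
    where
    add : ∀ {a b} → Content f a → Content f b → Content f (a + b)
    add {a} (h , i , e) (h′ , i′ , e′) with content-raise f i′ i {h} e | content-raise f i i′ {h′} e′
    ... | g , eg | g′ , eg′ = g +ₚ g′ , i +ℕ i′ ,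
      trans (coeffs (*ₚ-distribʳ f g g′) (i +ℕ i′))
        (trans (coeff-+ (g *ₚ f) (g′ *ₚ f) (i +ℕ i′))
          (+-cong (≡.subst (λ n → coeff (g *ₚ f) n ≈ a) (ℕ.+-comm i′ i) eg) eg′))

  Uni : Poly → Set (c ⊔ ℓ)
  Uni b = Content b 1#

  abstract
    uni-1 : Uni [ 1# ]ₚ
    uni-1 = [ 1# ]ₚ , 0 , trans (+-identityʳ _) (*-identityˡ 1#)

    nonZero⇒uni : ∀ {b} → NonZeroPoly b → Uni b
    nonZero⇒uni {b} (i , bᵢ≉0) with inverse (coeff b i) bᵢ≉0
    ... | r , e = [ r ]ₚ , i ,
      trans (coeffs ([]ₚ-*ₚ r b) i) (trans (coeff-· r b i) (trans (*-comm r _) e))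

  private
    module P = CommutativeRing polyRing
    module PS = SemiringSolver P.commutativeSemiring

  abstract
    -- Work modulo the content of `(h *ₚ b) *ₚ (h′ *ₚ b′)`, where this product vanishes. Since
    -- `h *ₚ b` has a coefficient 1, McCoy's theorem puts all coefficients of `h′ *ₚ b′` into that
    -- content, and one of them is 1.
    uni-* : ∀ {b b′} → Uni b → Uni b′ → Uni (b *ₚ b′)
    uni-* {b} {b′} (h , i , e) (h′ , i′ , e′) with content
      where
      open Unimodular (contentIdeal ((h *ₚ b) *ₚ (h′ *ₚ b′)))

      generators : AllIn ((h *ₚ b) *ₚ (h′ *ₚ b′))
      generators n = [ 1# ]ₚ , n , coeffs (*ₚ-identityˡ ((h *ₚ b) *ₚ (h′ *ₚ b′))) n

      content : Content ((h *ₚ b) *ₚ (h′ *ₚ b′)) 1#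
      content = IsIdeal.resp (contentIdeal ((h *ₚ b) *ₚ (h′ *ₚ b′))) e′
        (mccoy (h *ₚ b) i e (h′ *ₚ b′) generators i′)
    ... | g , n , e″ = g *ₚ (h *ₚ h′) , n , trans (coeffs regroup n) e″
      where
      regroup : (g *ₚ (h *ₚ h′)) *ₚ (b *ₚ b′) ≋ g *ₚ ((h *ₚ b) *ₚ (h′ *ₚ b′))
      regroup = PS.solve 5 (λ g h h′ b b′ → (g PS.:* (h PS.:* h′)) PS.:* (b PS.:* b′)
                  PS.:= g PS.:* ((h PS.:* b) PS.:* (h′ PS.:* b′))) ≋-refl g h h′ b b′

    -- McCoy's theorem for the zero ideal, applied to the multiple `h *ₚ b`, which has a coefficient
    -- 1.
    uni-regular : ∀ {b} → Uni b → ∀ {p q} → b *ₚ p ≋ b *ₚ q → p ≋ q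
    uni-regular {b} (h , i , e) {p} {q} bp≋bq =
      PR.x∙y⁻¹≈ε⇒x≈y p q
        (pointwise (mccoy (h *ₚ b) i e (p P.- q) (coeffs hb[p-q]≋0)))
      where
      open Unimodular zeroIdeal
      module PR = Algebra.Properties.Ring P.ring

      b[p-q]≋0 : b *ₚ (p P.- q) ≋ []
      b[p-q]≋0 = P.trans (P.distribˡ b p (negₚ q))
        (P.trans (P.+-cong bp≋bq (P.sym (PR.-‿distribʳ-* b q))) (P.-‿inverseʳ (b *ₚ q)))

      hb[p-q]≋0 : (h *ₚ b) *ₚ (p P.- q) ≋ []
      hb[p-q]≋0 = P.trans (P.*-assoc h b _) (P.trans (P.*-congˡ {h} b[p-q]≋0) (P.zeroʳ h))

-- Localisation of a commutative ring at regular denominators.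

record IsDenominatorSet {c ℓ d} (P : CommutativeRing c ℓ) (D : CommutativeRing.Carrier P → Set d) :
    Set (c ⊔ ℓ ⊔ d) where
  open CommutativeRing P
  field
    denominator-1 : D 1#
    denominator-* : ∀ {a b} → D a → D b → D (a * b)
    regular : ∀ {s} → D s → ∀ {a b} → s * a ≈ s * b → a ≈ b

module Localisation {c ℓ d} (P : CommutativeRing c ℓ) (D : CommutativeRing.Carrier P → Set d)
  (isDenominatorSet : IsDenominatorSet P D)
  where

  open CommutativeRing P
  open IsDenominatorSet isDenominatorSet
  open SemiringSolver commutativeSemiring using (solve; _:=_; _:+_; _:*_)
  private module R = Algebra.Properties.Ring ring

  record Q : Set (c ⊔ d) where
    constructor frac
    field
      num den : Carrier
      isDen : D den
  open Q public

  infix 4 _≈Q_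
  record _≈Q_ (x y : Q) : Set ℓ where
    constructor cross
    field uncross : num x * den y ≈ num y * den x
  open _≈Q_ public

  infixl 6 _+Q_
  infixl 7 _*Q_

  _+Q_ _*Q_ : Q → Q → Q
  frac a b u +Q frac a′ b′ u′ = frac (a * b′ + a′ * b) (b * b′) (denominator-* u u′)
  frac a b u *Q frac a′ b′ u′ = frac (a * a′) (b * b′) (denominator-* u u′)

  -Q_ : Q → Q
  -Q frac a b u = frac (- a) b u

  0Q 1Q : Q
  0Q = frac 0# 1# denominator-1
  1Q = frac 1# 1# denominator-1

  -- Regularity of the middle denominator is what makes plain cross multiplication, without an
  -- auxiliary factor, transitive.
  ≈Q-trans : ∀ {x y z} → x ≈Q y → y ≈Q z → x ≈Q z
  ≈Q-trans {frac a b _} {frac a′ b′ u′} {frac a″ b″ _} (cross e) (cross f) =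
    cross (regular u′ (begin
      b′ * (a * b″)    ≈⟨ solve 3 (λ a b′ b″ → b′ :* (a :* b″) := (a :* b′) :* b″) refl a b′ b″ ⟩
      (a * b′) * b″    ≈⟨ *-congʳ e ⟩
      (a′ * b) * b″    ≈⟨ solve 3 (λ a′ b b″ → (a′ :* b) :* b″ := (a′ :* b″) :* b) refl a′ b b″ ⟩
      (a′ * b″) * b    ≈⟨ *-congʳ f ⟩
      (a″ * b′) * b    ≈⟨ solve 3 (λ a″ b′ b → (a″ :* b′) :* b := b′ :* (a″ :* b)) refl a″ b′ b ⟩
      b′ * (a″ * b)    ∎))
    where open SetoidReasoning setoid

  +Q-cong : ∀ {x y x′ y′} → x ≈Q y → x′ ≈Q y′ → x +Q x′ ≈Q y +Q y′
  +Q-cong {frac a b _} {frac c d _} {frac a′ b′ _} {frac c′ d′ _} (cross e) (cross f) =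
    cross (begin
      (a * b′ + a′ * b) * (d * d′)
        ≈⟨ solve 6 (λ a b a′ b′ d d′ → (a :* b′ :+ a′ :* b) :* (d :* d′)
             := (a :* d) :* (b′ :* d′) :+ (a′ :* d′) :* (b :* d)) refl a b a′ b′ d d′ ⟩
      (a * d) * (b′ * d′) + (a′ * d′) * (b * d)
        ≈⟨ +-cong (*-congʳ e) (*-congʳ f) ⟩
      (c * b) * (b′ * d′) + (c′ * b′) * (b * d)
        ≈⟨ solve 6 (λ c d c′ d′ b b′ → (c :* b) :* (b′ :* d′) :+ (c′ :* b′) :* (b :* d)
             := (c :* d′ :+ c′ :* d) :* (b :* b′)) refl c d c′ d′ b b′ ⟩
      (c * d′ + c′ * d) * (b * b′) ∎)
    where open SetoidReasoning setoid

  *Q-cong : ∀ {x y x′ y′} → x ≈Q y → x′ ≈Q y′ → x *Q x′ ≈Q y *Q y′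
  *Q-cong {frac a b _} {frac c d _} {frac a′ b′ _} {frac c′ d′ _} (cross e) (cross f) =
    cross (begin
      (a * a′) * (d * d′)
        ≈⟨ solve 4 (λ a a′ d d′ → (a :* a′) :* (d :* d′) := (a :* d) :* (a′ :* d′)) refl a a′ d d′ ⟩
      (a * d) * (a′ * d′)
        ≈⟨ *-cong e f ⟩
      (c * b) * (c′ * b′)
        ≈⟨ solve 4 (λ c c′ b b′ → (c :* b) :* (c′ :* b′) := (c :* c′) :* (b :* b′)) refl c c′ b b′ ⟩
      (c * c′) * (b * b′) ∎)
    where open SetoidReasoning setoid

  -Q-cong : ∀ {x y} → x ≈Q y → -Q x ≈Q -Q y
  -Q-cong {frac a b _} {frac c d _} (cross e) = cross
    (trans (sym (R.-‿distribˡ-* a d)) (trans (-‿cong e) (R.-‿distribˡ-* c b)))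

  -Q-inverseˡ : ∀ x → -Q x +Q x ≈Q 0Q
  -Q-inverseˡ (frac a b _) = cross (begin
    (- a * b + a * b) * 1#    ≈⟨ *-identityʳ _ ⟩
    - a * b + a * b           ≈⟨ distribʳ b (- a) a ⟨
    (- a + a) * b             ≈⟨ *-congʳ (-‿inverseˡ a) ⟩
    0# * b                    ≈⟨ zeroˡ b ⟩
    0#                        ≈⟨ zeroˡ (b * b) ⟨
    0# * (b * b)              ∎)
    where open SetoidReasoning setoid

  +Q-assoc : ∀ x y z → (x +Q y) +Q z ≈Q x +Q (y +Q z)
  +Q-assoc (frac a b _) (frac a′ b′ _) (frac a″ b″ _) = cross
    (solve 6 (λ a b a′ b′ a″ b″ →
      ((a :* b′ :+ a′ :* b) :* b″ :+ a″ :* (b :* b′)) :* (b :* (b′ :* b″))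
      := (a :* (b′ :* b″) :+ (a′ :* b″ :+ a″ :* b′) :* b) :* ((b :* b′) :* b″))
      refl a b a′ b′ a″ b″)

  +Q-comm : ∀ x y → x +Q y ≈Q y +Q x
  +Q-comm (frac a b _) (frac a′ b′ _) = cross
    (solve 4 (λ a b a′ b′ → (a :* b′ :+ a′ :* b) :* (b′ :* b) := (a′ :* b :+ a :* b′) :* (b :* b′))
      refl a b a′ b′)

  +Q-identityˡ : ∀ x → 0Q +Q x ≈Q x
  +Q-identityˡ (frac a b _) = cross (*-cong
    (trans (+-congʳ (zeroˡ b)) (trans (+-identityˡ _) (*-identityʳ a))) (sym (*-identityˡ b)))

  *Q-assoc : ∀ x y z → (x *Q y) *Q z ≈Q x *Q (y *Q z)
  *Q-assoc (frac a b _) (frac a′ b′ _) (frac a″ b″ _) =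
    cross (*-cong (*-assoc a a′ a″) (sym (*-assoc b b′ b″)))

  *Q-comm : ∀ x y → x *Q y ≈Q y *Q x
  *Q-comm (frac a b _) (frac a′ b′ _) = cross (*-cong (*-comm a a′) (*-comm b′ b))

  *Q-identityˡ : ∀ x → 1Q *Q x ≈Q x
  *Q-identityˡ (frac a b _) = cross (*-cong (*-identityˡ a) (sym (*-identityˡ b)))

  *Q-distribʳ : ∀ x y z → (y +Q z) *Q x ≈Q (y *Q x) +Q (z *Q x)
  *Q-distribʳ (frac a b _) (frac a′ b′ _) (frac a″ b″ _) = cross
    (solve 6 (λ a b a′ b′ a″ b″ →
      ((a′ :* b″ :+ a″ :* b′) :* a) :* ((b′ :* b) :* (b″ :* b))
      := ((a′ :* a) :* (b″ :* b) :+ (a″ :* a) :* (b′ :* b)) :* ((b′ :* b″) :* b))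
      refl a b a′ b′ a″ b″)

  localisation : CommutativeRing (c ⊔ d) ℓ
  localisation = record
    { Carrier = Q
    ; _≈_ = _≈Q_
    ; _+_ = _+Q_
    ; _*_ = _*Q_
    ; -_ = -Q_
    ; 0# = 0Q
    ; 1# = 1Q
    ; isCommutativeRing = record
      { isRing = record
        { +-isAbelianGroup = record
          { isGroup = record
            { isMonoid = record
              { isSemigroup = record
                { isMagma = record
                  { isEquivalence = record
                    { refl = cross refl
                    ; sym = λ (cross e) → cross (sym e)
                    ; trans = ≈Q-trans
                    }
                  ; ∙-cong = +Q-cong
                  }
                ; assoc = +Q-assoc
                }
              ; identity = +Q-identityˡ , λ x → ≈Q-trans (+Q-comm x 0Q) (+Q-identityˡ x)
              }
            ; inverse = -Q-inverseˡ , λ x → ≈Q-trans (+Q-comm x (-Q x)) (-Q-inverseˡ x)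
            ; ⁻¹-cong = -Q-cong
            }
          ; comm = +Q-comm
          }
        ; *-cong = *Q-cong
        ; *-assoc = *Q-assoc
        ; *-identity = *Q-identityˡ , λ x → ≈Q-trans (*Q-comm x 1Q) (*Q-identityˡ x)
        ; distrib =
            (λ x y z → ≈Q-trans (*Q-comm x (y +Q z))
              (≈Q-trans (*Q-distribʳ x y z) (+Q-cong (*Q-comm y x) (*Q-comm z x))))
            , *Q-distribʳ
        }
      ; *-comm = *Q-comm
      }
    }

  cancel-factor : ∀ h a b u u′ → frac (h * a) (h * b) u ≈Q frac a b u′
  cancel-factor h a b u u′ = cross
    (solve 3 (λ h a b → (h :* a) :* b := a :* (h :* b)) refl h a b)

  scale : ∀ t a {ta} → t * a ≈ ta → ∀ b u → frac ta b u ≈Q frac t 1# denominator-1 *Q frac a b u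
  scale t a ta≈ b u = cross (*-cong (sym ta≈) (*-identityˡ b))

  -- For `s = a / b` and `d = a′ / b′` the fraction is `x s / (1 - x d)`, with `e = b′ - x a′`. The
  -- relation for `e` is stated additively because the semiring solver has no subtraction.
  feedback : ∀ x a {b a′ b′ e u v w} v′ → e + x * a′ ≈ b′ →
    frac x 1# denominator-1 *Q
      (frac a b u +Q frac ((x * a) * b′) (b * e) v *Q frac a′ b′ w)
    ≈Q frac ((x * a) * b′) (b * e) v′
  feedback x a {b} {a′} {b′} {e} v′ e+xa′≈b′ = cross (begin
    (x * (a * ((b * e) * b′) + (((x * a) * b′) * a′) * b)) * (b * e)
      ≈⟨ solve 6 (λ x a b a′ b′ e →
           (x :* (a :* ((b :* e) :* b′) :+ (((x :* a) :* b′) :* a′) :* b)) :* (b :* e)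
           := (((x :* a) :* b′) :* (b :* (b :* e))) :* (e :+ x :* a′)) refl x a b a′ b′ e ⟩
    (((x * a) * b′) * (b * (b * e))) * (e + x * a′)
      ≈⟨ *-congˡ e+xa′≈b′ ⟩
    (((x * a) * b′) * (b * (b * e))) * b′
      ≈⟨ solve 5 (λ x a b b′ e → (((x :* a) :* b′) :* (b :* (b :* e))) :* b′
           := ((x :* a) :* b′) :* (b :* ((b :* e) :* b′))) refl x a b b′ e ⟩
    ((x * a) * b′) * (b * ((b * e) * b′))
      ≈⟨ *-congˡ (*-identityˡ _) ⟨
    ((x * a) * b′) * (1# * (b * ((b * e) * b′))) ∎)
    where open SetoidReasoning setoid

-- The ring `k(x)` and its rational elements.

module RationalFunctions {c ℓ} (k : Field c ℓ) where
  open Theory k renaming (_+ₚ_ to infixl 6 _+ₚ_; _*ₚ_ to infixl 7 _*ₚ_; _·ₚ_ to infixr 8 _·ₚ_)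
  open Polynomials k

  uni-isDenominatorSet : IsDenominatorSet polyRing Uni
  uni-isDenominatorSet = record
    { denominator-1 = uni-1 ; denominator-* = uni-* ; regular = uni-regular }

  open Localisation polyRing Uni uni-isDenominatorSet
  private
    module F = Field k
    module P = CommutativeRing polyRing
    module Q′ = CommutativeRing localisation

  embed : Kx → Q
  embed (a / b ∶ b≠0) = frac a b (nonZero⇒uni b≠0)

  -- `Kx` asks for a denominator with a known nonzero coefficient. Expanding by the multiplier `h`
  -- from the proof of unimodularity produces a coefficient 1 at index `i`.
  normalise : Q → Kx
  normalise (frac a b (h , i , e)) =
    (h *ₚ a) / (h *ₚ b) ∶ (i , λ hbᵢ≈0 → F.0≉1 (F.trans (F.sym hbᵢ≈0) e))

  embed-normalise : ∀ x → embed (normalise x) ≈Q x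
  embed-normalise (frac a b (h , _)) = cancel-factor h a b _ _

  infix 4 _≈K_
  -- Equality is pulled back along `embed`, which makes `embed` injective by definition and lets the
  -- ring laws descend from the localisation.
  record _≈K_ (p q : Kx) : Set ℓ where
    constructor embedded
    field embeds : embed p ≈Q embed q
  open _≈K_ public

  infixl 6 _+K_
  infixl 7 _*K_

  abstract
    -- Sealed, so that the reasoning about circuits uses ring laws instead of representatives.
    _+K_ _*K_ : Kx → Kx → Kx
    p +K q = normalise (embed p +Q embed q)
    p *K q = normalise (embed p *Q embed q)

    -K_ : Kx → Kx
    -K p = normalise (-Q embed p)

    0K 1K : Kx
    0K = normalise 0Q
    1K = normalise 1Q

    isCommutativeRingK : IsCommutativeRing _≈K_ _+K_ _*K_ -K_ 0K 1K
    isCommutativeRingK =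
      RingMonomorphism.isCommutativeRing embed-isRingMonomorphism Q′.isCommutativeRing
      where
      embed-isRingMonomorphism : IsRingMonomorphism
        (record { _≈_ = _≈K_ ; _+_ = _+K_ ; _*_ = _*K_ ; -_ = -K_ ; 0# = 0K ; 1# = 1K })
        Q′.rawRing embed
      embed-isRingMonomorphism = record
        { isRingHomomorphism = record
          { isSemiringHomomorphism = record
            { isNearSemiringHomomorphism = record
              { +-isMonoidHomomorphism = record
                { isMagmaHomomorphism = record
                  { isRelHomomorphism = record { cong = embeds }
                  ; homo = λ p q → embed-normalise _
                  }
                ; ε-homo = embed-normalise 0Q
                }
              ; *-homo = λ p q → embed-normalise _
              }
            ; 1#-homo = embed-normalise 1Q
            }
          ; -‿homo = λ p → embed-normalise _
          }
        ; injective = embedded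
        }

  K : CommutativeRing _ _
  K = record { isCommutativeRing = isCommutativeRingK }

  private module K = CommutativeRing K

  xₚ : Poly
  xₚ = F.0# ∷ F.1# ∷ []

  xₚ-* : ∀ p → xₚ *ₚ p ≋ F.0# ∷ p
  xₚ-* p = ≋-trans (0∷-*ₚ [ F.1# ]ₚ p) (∷-cong F.refl (*ₚ-identityˡ p))

  polynomial : Poly → Q
  polynomial p = frac p [ F.1# ]ₚ uni-1

  abstract
    X : Kx
    X = normalise (polynomial xₚ)

    scalar : F.Carrier → Kx
    scalar r = normalise (polynomial [ r ]ₚ)

  -- Generators as equations in `K`, and the subring of rational elements.

  ≈ₖ⇔ : ∀ p q → ↑ (p ≈ₖ q) ⇔ (p K.≈ q)
  ≈ₖ⇔ p q = mk⇔ (λ (lift e) → embedded (cross (pointwise e)))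
                (λ (embedded (cross e)) → lift (coeffs e))

  private
    -- The generators compute with raw pairs and the ring operations with normalised fractions; both
    -- represent the same element of the localisation.
    ↑⇔ : ∀ x r {y} → x ≈Q y → ↑ ((num x , den x) ≈ᶠ ⌊ r ⌋) ⇔ (normalise y K.≈ r)
    ↑⇔ x r x≈y = mk⇔
      (λ (lift e) → embedded
        (Q′.trans (embed-normalise _) (Q′.trans (Q′.sym x≈y) (cross (pointwise e)))))
      (λ (embedded e) → lift
        (coeffs (uncross (Q′.trans x≈y (Q′.trans (Q′.sym (embed-normalise _)) e)))))

  abstract
    add⇔ : ∀ p q r → ↑ ((⌊ p ⌋ +ᶠ ⌊ q ⌋) ≈ᶠ ⌊ r ⌋) ⇔ (p K.+ q K.≈ r)
    add⇔ p q r = ↑⇔ (embed p +Q embed q) r Q′.refl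

    zer⇔ : ∀ r → ↑ (0ᶠ ≈ᶠ ⌊ r ⌋) ⇔ (K.0# K.≈ r)
    zer⇔ r = ↑⇔ 0Q r Q′.refl

    one⇔ : ∀ r → ↑ (1ᶠ ≈ᶠ ⌊ r ⌋) ⇔ (K.1# K.≈ r)
    one⇔ r = ↑⇔ 1Q r Q′.refl

    private
      multiply⇔ : ∀ t x p r → x ≈Q t *Q embed p →
        ↑ ((num x , den x) ≈ᶠ ⌊ r ⌋) ⇔ (normalise t K.* p K.≈ r)
      multiply⇔ t x p r x≈ = ↑⇔ x r (Q′.trans x≈
        (*Q-cong {t} {embed (normalise t)} {embed p} {embed p}
          (Q′.sym {embed (normalise t)} {t} (embed-normalise t)) (Q′.refl {embed p})))

    reg⇔ : ∀ p r → ↑ (xᶠ ⌊ p ⌋ ≈ᶠ ⌊ r ⌋) ⇔ (X K.* p K.≈ r)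
    reg⇔ p@(a / b ∶ _) r = multiply⇔ (polynomial xₚ) (frac (F.0# ∷ a) b (isDen (embed p))) p r
      (scale xₚ a (xₚ-* a) b (isDen (embed p)))

    amp⇔ : ∀ s p r → ↑ (sᶠ s ⌊ p ⌋ ≈ᶠ ⌊ r ⌋) ⇔ (scalar s K.* p K.≈ r)
    amp⇔ s p@(a / b ∶ _) r = multiply⇔ (polynomial [ s ]ₚ) (frac (s ·ₚ a) b (isDen (embed p))) p r
      (scale [ s ]ₚ a ([]ₚ-*ₚ s a) b (isDen (embed p)))

  -- Over a field a nonzero constant term can be scaled to 1. In this form the condition is an
  -- equation that visibly survives products.
  UnitConstantTerm : Q → Set ℓ
  UnitConstantTerm x = coeff (den x) 0 F.≈ F.1#

  Rational : Kx → Set (c ⊔ ℓ)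
  Rational p = ∃[ x ] (UnitConstantTerm x × embed p ≈Q x)

  coeff₀-* : ∀ p q → coeff (p *ₚ q) 0 F.≈ coeff p 0 F.* coeff q 0
  coeff₀-* []      q = F.sym (F.zeroˡ _)
  coeff₀-* (a ∷ p) q = F.trans (coeff-+ (a ·ₚ q) (F.0# ∷ (p *ₚ q)) 0)
    (F.trans (F.+-identityʳ _) (coeff-· a q 0))

  private
    coeff₀-*-unit : ∀ {p q} → coeff p 0 F.≈ F.1# → coeff q 0 F.≈ F.1# → coeff (p *ₚ q) 0 F.≈ F.1#
    coeff₀-*-unit {p} {q} e f = F.trans (coeff₀-* p q) (F.trans (F.*-cong e f) (F.*-identityˡ F.1#))

    rational-normalise : ∀ x → UnitConstantTerm x → Rational (normalise x)
    rational-normalise x u = x , u , embed-normalise x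

  abstract
    rational-0 : Rational K.0#
    rational-0 = rational-normalise 0Q F.refl

    rational-1 : Rational K.1#
    rational-1 = rational-normalise 1Q F.refl

    rational-X : Rational X
    rational-X = rational-normalise (polynomial xₚ) F.refl

    rational-scalar : ∀ r → Rational (scalar r)
    rational-scalar r = rational-normalise (polynomial [ r ]ₚ) F.refl

    rational-+ : ∀ {p q} → Rational p → Rational q → Rational (p K.+ q)
    rational-+ (x , u , e) (y , v , f) =
      x +Q y , coeff₀-*-unit {den x} {den y} u v , Q′.trans (embed-normalise _) (+Q-cong e f)

    rational-* : ∀ {p q} → Rational p → Rational q → Rational (p K.* q)
    rational-* (x , u , e) (y , v , f) =
      x *Q y , coeff₀-*-unit {den x} {den y} u v , Q′.trans (embed-normalise _) (*Q-cong e f)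

    rational-neg : ∀ {p} → Rational p → Rational (K.- p)
    rational-neg (x , u , e) = -Q x , u , Q′.trans (embed-normalise _) (-Q-cong e)

    -- z = x s / (1 - x d), and 1 - x d has constant term 1.
    rational-feedback : ∀ {s d} → Rational s → Rational d →
      ∃[ z ] (Rational z × X K.* (s K.+ z K.* d) K.≈ z)
    rational-feedback {s} {d} (frac a b u , b₀≈1 , s≈) (frac a′ b′ u′ , b′₀≈1 , d≈) =
      normalise z , rational-normalise z ze₀≈1 , embedded (begin
        embed (X K.* (s K.+ normalise z K.* d))
          ≈⟨ embed-normalise _ ⟩
        embed X *Q embed (s K.+ normalise z K.* d)
          ≈⟨ *Q-cong (embed-normalise _) (Q′.trans (embed-normalise _)
               (+Q-cong s≈ (Q′.trans (embed-normalise _) (*Q-cong (embed-normalise _) d≈)))) ⟩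
        polynomial xₚ *Q (frac a b u +Q z *Q frac a′ b′ u′)
          ≈⟨ feedback xₚ a (isDen z) e+xa′≋b′ ⟩
        z
          ≈⟨ embed-normalise z ⟨
        embed (normalise z) ∎)
      where
      open SetoidReasoning Q′.setoid

      -- With `d = a′ / b′`, this is the numerator of `1 - x d` over `b′`.
      e : Poly
      e = b′ P.- xₚ *ₚ a′

      e₀≈1 : coeff e 0 F.≈ F.1#
      e₀≈1 = F.trans (coeff-+ b′ (negₚ (xₚ *ₚ a′)) 0)
        (F.trans (F.+-cong b′₀≈1
            (F.trans (coeff-· (F.- F.1#) (xₚ *ₚ a′) 0)
              (F.trans (F.*-congˡ (coeffs (xₚ-* a′) 0)) (F.zeroʳ _))))
          (F.+-identityʳ F.1#))

      ze₀≈1 : coeff (b *ₚ e) 0 F.≈ F.1#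
      ze₀≈1 = coeff₀-*-unit {b} {e} b₀≈1 e₀≈1

      e+xa′≋b′ : e +ₚ xₚ *ₚ a′ ≋ b′
      e+xa′≋b′ = P.trans (+ₚ-assoc b′ (negₚ (xₚ *ₚ a′)) (xₚ *ₚ a′))
        (P.trans (P.+-congˡ {b′} (P.-‿inverseˡ (xₚ *ₚ a′))) (+ₚ-identityʳ b′))

      z : Q
      z = frac ((xₚ *ₚ a) *ₚ b′) (b *ₚ e)
            (uni-* u ([ F.1# ]ₚ , 0 , F.trans (coeffs (*ₚ-identityˡ e) 0) e₀≈1))

-- Denotations: invariance under equality, linearity and traces.

module Circuits {a ℓ} (k : Field a ℓ) where
  open Theory k
  open RationalFunctions k
  open CommutativeRing K
  open SemiringSolver commutativeSemiring using (solve; _:=_; _:+_; _:*_)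
  open Equivalence using (to; from)

  infix 4 _≋ᵛ_
  _≋ᵛ_ : ∀ {n} → Vec Kx n → Vec Kx n → Set (a ⊔ ℓ)
  _≋ᵛ_ = Pointwise _≈_

  ≋ᵛ-refl : ∀ {n} {u : Vec Kx n} → u ≋ᵛ u
  ≋ᵛ-refl = Pointwise.refl refl

  ≋ᵛ-sym : ∀ {n} {u v : Vec Kx n} → u ≋ᵛ v → v ≋ᵛ u
  ≋ᵛ-sym = Pointwise.sym sym

  ≋ᵛ-trans : ∀ {n} {u v w : Vec Kx n} → u ≋ᵛ v → v ≋ᵛ w → u ≋ᵛ w
  ≋ᵛ-trans = Pointwise.trans trans

  ≡⇒≋ᵛ : ∀ {n} {u v : Vec Kx n} → u ≡ v → u ≋ᵛ v
  ≡⇒≋ᵛ ≡.refl = ≋ᵛ-refl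

  take⁺ : ∀ n {m} {u v : Vec Kx (n +ℕ m)} → u ≋ᵛ v → take n u ≋ᵛ take n v
  take⁺ zero    es                               = []
  take⁺ (suc n) {u = _ ∷ _} {v = _ ∷ _} (e ∷ es) = e ∷ take⁺ n es

  drop⁺ : ∀ n {m} {u v : Vec Kx (n +ℕ m)} → u ≋ᵛ v → drop n u ≋ᵛ drop n v
  drop⁺ zero    es                               = es
  drop⁺ (suc n) {u = _ ∷ _} {v = _ ∷ _} (e ∷ es) = drop⁺ n es

  take-++ : ∀ {n m} (u : Vec Kx n) (v : Vec Kx m) → take n (u ++ v) ≡ u
  take-++ {n} u v = Vec.++-injectiveˡ _ _ (Vec.take++drop≡id n (u ++ v))

  drop-++ : ∀ {n m} (u : Vec Kx n) (v : Vec Kx m) → drop n (u ++ v) ≡ v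
  drop-++ {n} u v = Vec.++-injectiveʳ (take n (u ++ v)) u (Vec.take++drop≡id n (u ++ v))

  -- Relations are given on representatives of fractions, so invariance under `≈` has to be proved
  -- for each denotation.
  Respects : ∀ {n m} → Rel n m → Set (a ⊔ ℓ)
  Respects R = ∀ {u u′ v v′} → u ≋ᵛ u′ → v ≋ᵛ v′ → R u v → R u′ v′

  private
    module _ {x y x′ y′ : Kx} {A A′ : Set (a ⊔ ℓ)} where
      transport : A ⇔ (x ≈ y) → A′ ⇔ (x′ ≈ y′) → x ≈ x′ → y ≈ y′ → A → A′
      transport e e′ x≈x′ y≈y′ r = from e′ (trans (sym x≈x′) (trans (to e r) y≈y′))

  copy-respects : Respects ⟦copy⟧
  copy-respects {x ∷ []} {x′ ∷ []} {y ∷ z ∷ []} {y′ ∷ z′ ∷ []} (p ∷ []) (q ∷ r ∷ []) (e , f) =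
    transport (≈ₖ⇔ x y) (≈ₖ⇔ x′ y′) p q e , transport (≈ₖ⇔ x z) (≈ₖ⇔ x′ z′) p r f

  disc-respects : Respects ⟦disc⟧
  disc-respects {_ ∷ []} {_ ∷ []} {[]} {[]} _ _ _ = tt

  add-respects : Respects ⟦add⟧
  add-respects {x ∷ y ∷ []} {x′ ∷ y′ ∷ []} {z ∷ []} {z′ ∷ []} (p ∷ q ∷ []) (r ∷ []) =
    transport (add⇔ x y z) (add⇔ x′ y′ z′) (+-cong p q) r

  zer-respects : Respects ⟦zer⟧
  zer-respects {[]} {[]} {z ∷ []} {z′ ∷ []} [] (r ∷ []) = transport (zer⇔ z) (zer⇔ z′) refl r

  one-respects : Respects ⟦one⟧
  one-respects {[]} {[]} {z ∷ []} {z′ ∷ []} [] (r ∷ []) = transport (one⇔ z) (one⇔ z′) refl r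

  reg-respects : Respects ⟦reg⟧
  reg-respects {x ∷ []} {x′ ∷ []} {z ∷ []} {z′ ∷ []} (p ∷ []) (r ∷ []) =
    transport (reg⇔ x z) (reg⇔ x′ z′) (*-congˡ p) r

  amp-respects : ∀ r → Respects (⟦amp⟧ r)
  amp-respects s {x ∷ []} {x′ ∷ []} {z ∷ []} {z′ ∷ []} (p ∷ []) (r ∷ []) =
    transport (amp⇔ s x z) (amp⇔ s x′ z′) (*-congˡ p) r

  ⟦⟧-respects : ∀ {n m} (c : ACirc n m) → Respects ⟦ c ⟧
  ⟦⟧-respects copy u v = copy-respects u v
  ⟦⟧-respects disc u v = disc-respects u v
  ⟦⟧-respects add u v = add-respects u v
  ⟦⟧-respects zer u v = zer-respects u v
  ⟦⟧-respects one u v = one-respects u v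
  ⟦⟧-respects reg u v = reg-respects u v
  ⟦⟧-respects (amp r) u v = amp-respects r u v
  ⟦⟧-respects copyᵒᵖ u v = copy-respects v u
  ⟦⟧-respects discᵒᵖ u v = disc-respects v u
  ⟦⟧-respects addᵒᵖ u v = add-respects v u
  ⟦⟧-respects zerᵒᵖ u v = zer-respects v u
  ⟦⟧-respects oneᵒᵖ u v = one-respects v u
  ⟦⟧-respects regᵒᵖ u v = reg-respects v u
  ⟦⟧-respects (ampᵒᵖ r) u v = amp-respects r v u
  ⟦⟧-respects id₀ {[]} {[]} {[]} {[]} _ _ _ = tt
  ⟦⟧-respects id₁ {x ∷ []} {x′ ∷ []} {y ∷ []} {y′ ∷ []} (p ∷ []) (q ∷ []) =
    transport (≈ₖ⇔ x y) (≈ₖ⇔ x′ y′) p q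
  ⟦⟧-respects sw {x ∷ y ∷ []} {x′ ∷ y′ ∷ []} {z ∷ w ∷ []} {z′ ∷ w′ ∷ []} (p ∷ q ∷ []) (r ∷ s ∷ []) (e , f) =
    transport (≈ₖ⇔ x w) (≈ₖ⇔ x′ w′) p s e , transport (≈ₖ⇔ y z) (≈ₖ⇔ y′ z′) q r f
  ⟦⟧-respects (c ⨾ d) u v (w , r , s) =
    w , ⟦⟧-respects c u ≋ᵛ-refl r , ⟦⟧-respects d ≋ᵛ-refl v s
  ⟦⟧-respects (_⊕_ {n₁} {m₁} c d) u v (r , s) =
    ⟦⟧-respects c (take⁺ n₁ u) (take⁺ m₁ v) r , ⟦⟧-respects d (drop⁺ n₁ u) (drop⁺ m₁ v) s

  comb : ∀ {n} → Kx → Vec Kx n → Vec Kx n → Vec Kx n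
  comb s = zipWith λ p q → s * p + q

  -- For a nonempty relation this says that it is a submodule: `s = -1` on a pair and itself gives
  -- zero, and then scalar multiples and sums follow. The empty relation qualifies too, which is why
  -- comparing slices later requires a point.
  Linear : ∀ {n m} → Rel n m → Set (a ⊔ ℓ)
  Linear R = ∀ s {u u′ v v′} → R u v → R u′ v′ → R (comb s u u′) (comb s v v′)

  private
    module _ {x y x′ y′ z w : Kx} {A A′ B : Set (a ⊔ ℓ)} where
      combine : A ⇔ (x ≈ y) → A′ ⇔ (x′ ≈ y′) → B ⇔ (z ≈ w) →
        ∀ s → z ≈ s * x + x′ → w ≈ s * y + y′ → A → A′ → B
      combine e e′ f s z≈ w≈ r r′ =
        from f (trans z≈ (trans (+-cong (*-congˡ (to e r)) (to e′ r′)) (sym w≈)))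

    scaled : ∀ t s p q → t * (s * p + q) ≈ s * (t * p) + t * q
    scaled = solve 4 (λ t s p q → t :* (s :* p :+ q) := s :* (t :* p) :+ t :* q) refl

    combine≈ : ∀ s x y x′ y′ → ↑ (x ≈ₖ y) → ↑ (x′ ≈ₖ y′) → ↑ ((s * x + x′) ≈ₖ (s * y + y′))
    combine≈ s x y x′ y′ = combine (≈ₖ⇔ x y) (≈ₖ⇔ x′ y′) (≈ₖ⇔ _ _) s refl refl

  copy-linear : Linear ⟦copy⟧
  copy-linear s {x ∷ []} {x′ ∷ []} {y ∷ z ∷ []} {y′ ∷ z′ ∷ []} (e , f) (e′ , f′) =
    combine≈ s x y x′ y′ e e′ , combine≈ s x z x′ z′ f f′

  disc-linear : Linear ⟦disc⟧
  disc-linear s {_ ∷ []} {_ ∷ []} {[]} {[]} _ _ = tt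

  add-linear : Linear ⟦add⟧
  add-linear s {p ∷ q ∷ []} {p′ ∷ q′ ∷ []} {r ∷ []} {r′ ∷ []} =
    combine (add⇔ p q r) (add⇔ p′ q′ r′) (add⇔ _ _ _) s
      (solve 5 (λ s p q p′ q′ → (s :* p :+ p′) :+ (s :* q :+ q′) := s :* (p :+ q) :+ (p′ :+ q′))
        refl s p q p′ q′)
      refl

  zer-linear : Linear ⟦zer⟧
  zer-linear s {[]} {[]} {r ∷ []} {r′ ∷ []} =
    combine (zer⇔ r) (zer⇔ r′) (zer⇔ _) s (sym (trans (+-identityʳ _) (zeroʳ s))) refl

  reg-linear : Linear ⟦reg⟧
  reg-linear s {p ∷ []} {p′ ∷ []} {r ∷ []} {r′ ∷ []} =
    combine (reg⇔ p r) (reg⇔ p′ r′) (reg⇔ _ _) s (scaled X s p p′) refl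

  amp-linear : ∀ r → Linear (⟦amp⟧ r)
  amp-linear t s {p ∷ []} {p′ ∷ []} {r ∷ []} {r′ ∷ []} =
    combine (amp⇔ t p r) (amp⇔ t p′ r′) (amp⇔ t _ _) s (scaled (scalar t) s p p′) refl

  -- A recursive predicate rather than an equation of counts: it splits definitionally along `⨾` and
  -- `⊕`, as the induction for linearity does.
  OneFree : ∀ {n m} → ACirc n m → Set
  OneFree one     = ⊥
  OneFree oneᵒᵖ   = ⊥
  OneFree (c ⨾ d) = OneFree c × OneFree d
  OneFree (c ⊕ d) = OneFree c × OneFree d
  OneFree _       = ⊤

  ⟦⟧-linear : ∀ {n m} (c : ACirc n m) → OneFree c → Linear ⟦ c ⟧
  ⟦⟧-linear copy _ s x y = copy-linear s x y
  ⟦⟧-linear disc _ s x y = disc-linear s x y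
  ⟦⟧-linear add _ s x y = add-linear s x y
  ⟦⟧-linear zer _ s x y = zer-linear s x y
  ⟦⟧-linear reg _ s x y = reg-linear s x y
  ⟦⟧-linear (amp r) _ s x y = amp-linear r s x y
  ⟦⟧-linear copyᵒᵖ _ s x y = copy-linear s x y
  ⟦⟧-linear discᵒᵖ _ s x y = disc-linear s x y
  ⟦⟧-linear addᵒᵖ _ s x y = add-linear s x y
  ⟦⟧-linear zerᵒᵖ _ s x y = zer-linear s x y
  ⟦⟧-linear regᵒᵖ _ s x y = reg-linear s x y
  ⟦⟧-linear (ampᵒᵖ r) _ s x y = amp-linear r s x y
  ⟦⟧-linear id₀ _ s {[]} {[]} {[]} {[]} _ _ = tt
  ⟦⟧-linear id₁ _ s {x ∷ []} {x′ ∷ []} {y ∷ []} {y′ ∷ []} e e′ = combine≈ s x y x′ y′ e e′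
  ⟦⟧-linear sw _ s {x ∷ y ∷ []} {x′ ∷ y′ ∷ []} {z ∷ w ∷ []} {z′ ∷ w′ ∷ []} (e , f) (e′ , f′) =
    combine≈ s x w x′ w′ e e′ , combine≈ s y z y′ z′ f f′
  ⟦⟧-linear (c ⨾ d) (c-free , d-free) s (w , x , y) (w′ , x′ , y′) =
    comb s w w′ , ⟦⟧-linear c c-free s x x′ , ⟦⟧-linear d d-free s y y′
  ⟦⟧-linear (_⊕_ {n₁} {m₁} c d) (c-free , d-free) s {u} {u′} {v} {v′} (x , y) (x′ , y′)
    rewrite Vec.take-zipWith {m = n₁} (λ p q → s * p + q) u u′
          | Vec.drop-zipWith {m = n₁} (λ p q → s * p + q) u u′
          | Vec.take-zipWith {m = m₁} (λ p q → s * p + q) v v′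
          | Vec.drop-zipWith {m = m₁} (λ p q → s * p + q) v v′
    = ⟦⟧-linear c c-free s x x′ , ⟦⟧-linear d d-free s y y′

  id-to : ∀ n {u v} → ⟦ idₙ n ⟧ u v → u ≋ᵛ v
  id-to zero    {[]}    {[]}    _       = []
  id-to (suc n) {p ∷ u} {q ∷ v} (e , r) = to (≈ₖ⇔ p q) e ∷ id-to n r

  id-from : ∀ n {u v} → u ≋ᵛ v → ⟦ idₙ n ⟧ u v
  id-from zero    {[]}    {[]}    _        = tt
  id-from (suc n) {p ∷ u} {q ∷ v} (e ∷ es) = from (≈ₖ⇔ p q) e , id-from n es

  ≈ₖ-refl : ∀ p → ↑ (p ≈ₖ p)
  ≈ₖ-refl p = from (≈ₖ⇔ p p) refl

  -- Here `z` is the value fed back into `c` and `z′` the value that `c` sends to the register. With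
  -- `Tr-from` this reduces a trace to one fixed point equation.
  Tr-to : ∀ {n m} (c : ACirc (suc n) (suc m)) {u v} → ⟦ Tr c ⟧ u v →
    ∃[ z ] ∃[ z′ ] (⟦ c ⟧ (z ∷ u) (z′ ∷ v) × X * z′ ≈ z)
  Tr-to {n} {m} c
    ( (p₃ ∷ q₃ ∷ v₃)
    , ( (p₂ ∷ q₂ ∷ v₂)
      , ((p₁ ∷ q₁ ∷ u₁) , (((y ∷ []) , _ , (e₁ , f₁)) , i₁) , (e₂ , r))
      , ((e₃ , f₃) , i₃))
    , (((z ∷ []) , (e₄ , f₄) , _) , i₄)) =
    q₁ , q₂ , ⟦⟧-respects c (refl ∷ ≋ᵛ-sym (id-to n i₁)) (refl ∷ ≋ᵛ-trans (id-to m i₃) (id-to m i₄)) r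
    , (begin
        X * q₂    ≈⟨ to (reg⇔ q₂ q₃) f₃ ⟩
        q₃        ≈⟨ to (≈ₖ⇔ z q₃) f₄ ⟨
        z         ≈⟨ to (≈ₖ⇔ z p₃) e₄ ⟩
        p₃        ≈⟨ to (≈ₖ⇔ p₂ p₃) e₃ ⟨
        p₂        ≈⟨ to (≈ₖ⇔ p₁ p₂) e₂ ⟨
        p₁        ≈⟨ to (≈ₖ⇔ y p₁) e₁ ⟨
        y         ≈⟨ to (≈ₖ⇔ y q₁) f₁ ⟩
        q₁        ∎)
    where open SetoidReasoning setoid

  Tr-from : ∀ {n m} (c : ACirc (suc n) (suc m)) {u v z z′} →
    ⟦ c ⟧ (z ∷ u) (z′ ∷ v) → X * z′ ≈ z → ⟦ Tr c ⟧ u v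
  Tr-from {n} {m} c {u} {v} {z} {z′} r e =
    (z ∷ z ∷ v)
    , ( (z ∷ z′ ∷ v)
      , ( (z ∷ z ∷ u)
        , (((z ∷ []) , tt , (≈ₖ-refl z , ≈ₖ-refl z)) , id-from n ≋ᵛ-refl)
        , (≈ₖ-refl z , r))
      , ((≈ₖ-refl z , from (reg⇔ z′ z) e) , id-from m ≋ᵛ-refl))
    , (((z ∷ []) , (≈ₖ-refl z , ≈ₖ-refl z) , tt) , id-from m ≋ᵛ-refl)

-- Linear relations and their slices.

module Realisability {a ℓ} (k : Field a ℓ) where
  open Theory k
  open RationalFunctions k
  open Circuits k
  open CommutativeRing K
  open SemiringSolver commutativeSemiring using (solve; _:=_; _:+_; _:*_)
  open Equivalence using (to; from)
  private module R = Algebra.Properties.Ring ring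

  private
    cancel : ∀ {s s′} → s′ + s ≈ 0# → ∀ p q → s′ * p + (s * p + q) ≈ q
    cancel {s} {s′} e p q = begin
      s′ * p + (s * p + q)
        ≈⟨ solve 4 (λ s s′ p q → s′ :* p :+ (s :* p :+ q) := (s′ :+ s) :* p :+ q) refl s s′ p q ⟩
      (s′ + s) * p + q    ≈⟨ +-congʳ (*-congʳ e) ⟩
      0# * p + q          ≈⟨ +-congʳ (zeroˡ p) ⟩
      0# + q              ≈⟨ +-identityˡ q ⟩
      q                   ∎
      where open SetoidReasoning setoid

    -1*p+p≈0 : ∀ p → (- 1#) * p + p ≈ 0#
    -1*p+p≈0 p = trans (+-congʳ (R.-1*x≈-x p)) (-‿inverseˡ p)

  -- Undoes a translation by a multiple of `u`; this is the way back out of the slice.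
  comb-cancel : ∀ s {n} (u v : Vec Kx n) → comb (- s) u (comb s u v) ≋ᵛ v
  comb-cancel s []      []      = []
  comb-cancel s (p ∷ u) (q ∷ v) = cancel (-‿inverseˡ s) p q ∷ comb-cancel s u v

  -- Two runs on the same input differ by a run on input zero, so adding a multiple of their
  -- difference leaves the input unchanged.
  comb-difference : ∀ s {n} (u : Vec Kx n) → comb s (comb (- 1#) u u) u ≋ᵛ u
  comb-difference s []      = []
  comb-difference s (p ∷ u) =
    trans (+-congʳ (trans (*-congˡ (-1*p+p≈0 p)) (zeroʳ s))) (+-identityˡ p)
    ∷ comb-difference s u

  -- If (1 , w₀) lies in both relations, then (t , w) can be moved to the slice t = 1 by adding a
  -- multiple of (1 , w₀), and back.
  slice-⊆ : ∀ {n m} {R S : Rel (suc n) m} → Linear R → Linear S → Respects R → Respects S →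
    (∀ u v → R (1# ∷ u) v ⇔ S (1# ∷ u) v) →
    ∀ {u₀ v₀} → R (1# ∷ u₀) v₀ → ∀ {w v} → R w v → S w v
  slice-⊆ R-lin S-lin R-resp S-resp slice {u₀} {v₀} r₀ {t ∷ u} {v} r =
    S-resp (comb-cancel s (1# ∷ u₀) (t ∷ u)) (comb-cancel s v₀ v)
      (S-lin (- s) (to (slice _ _) r₀)
        (S-resp (sym head≈1 ∷ ≋ᵛ-refl) ≋ᵛ-refl
          (to (slice _ _) (R-resp (head≈1 ∷ ≋ᵛ-refl) ≋ᵛ-refl (R-lin s r₀ r)))))
    where
    s : Kx
    s = 1# - t

    head≈1 : s * 1# + t ≈ 1#
    head≈1 = begin
      s * 1# + t      ≈⟨ +-congʳ (*-identityʳ s) ⟩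
      (1# - t) + t    ≈⟨ +-assoc 1# (- t) t ⟩
      1# + (- t + t)  ≈⟨ +-congˡ (-‿inverseˡ t) ⟩
      1# + 0#         ≈⟨ +-identityʳ 1# ⟩
      1#              ∎
      where open SetoidReasoning setoid

  slice-≐ : ∀ {n m} {R S : Rel (suc n) m} → Linear R → Linear S → Respects R → Respects S →
    (∀ u v → R (1# ∷ u) v ⇔ S (1# ∷ u) v) → ∀ {u₀ v₀} → R (1# ∷ u₀) v₀ → R ≐ S
  slice-≐ R-lin S-lin R-resp S-resp slice r₀ w v =
    slice-⊆ R-lin S-lin R-resp S-resp slice r₀ ,
    slice-⊆ S-lin R-lin S-resp R-resp (λ u v → mk⇔ (from (slice u v)) (to (slice u v)))
      (to (slice _ _) r₀)

  -- Signal flow graphs are linear, and total on rational inputs.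

  oneFree-idₙ : ∀ n → OneFree (idₙ n)
  oneFree-idₙ zero    = tt
  oneFree-idₙ (suc n) = tt , oneFree-idₙ n

  sf⇒oneFree : ∀ {n m} {e : ACirc n m} → SF e → OneFree e
  sf⇒oneFree copy = tt
  sf⇒oneFree disc = tt
  sf⇒oneFree add = tt
  sf⇒oneFree zer = tt
  sf⇒oneFree reg = tt
  sf⇒oneFree (amp r) = tt
  sf⇒oneFree id₀ = tt
  sf⇒oneFree id₁ = tt
  sf⇒oneFree sw = tt
  sf⇒oneFree (seq c d) = sf⇒oneFree c , sf⇒oneFree d
  sf⇒oneFree (par c d) = sf⇒oneFree c , sf⇒oneFree d
  sf⇒oneFree (tr {n = n} {m = m} c) =
    ((((tt , tt) , oneFree-idₙ n) , (tt , sf⇒oneFree c)) , ((tt , tt) , oneFree-idₙ m))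
    , ((tt , tt) , oneFree-idₙ m)

  sf-linear : ∀ {n m} {e : ACirc n m} → SF e → Linear ⟦ e ⟧
  sf-linear {e = e} sf = ⟦⟧-linear e (sf⇒oneFree sf)

  comb-rational : ∀ {s n} {u v : Vec Kx n} →
    Rational s → All Rational u → All Rational v → All Rational (comb s u v)
  comb-rational rs []       []       = []
  comb-rational rs (p ∷ ps) (q ∷ qs) =
    rational-+ (rational-* rs p) q ∷ comb-rational rs ps qs

  -- For a trace, linearity makes the fed back value depend on its input z as s + z d.
  sf-total : ∀ {n m} {e : ACirc n m} → SF e → ∀ {u} → All Rational u →
    ∃[ v ] (All Rational v × ⟦ e ⟧ u v)
  sf-total copy {p ∷ []} (rp ∷ []) = p ∷ p ∷ [] , rp ∷ rp ∷ [] , ≈ₖ-refl p , ≈ₖ-refl p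
  sf-total disc {p ∷ []} _ = [] , [] , tt
  sf-total add {p ∷ q ∷ []} (rp ∷ rq ∷ []) =
    (p + q) ∷ [] , rational-+ rp rq ∷ [] , from (add⇔ p q _) refl
  sf-total zer {[]} [] = 0# ∷ [] , rational-0 ∷ [] , from (zer⇔ _) refl
  sf-total reg {p ∷ []} (rp ∷ []) =
    (X * p) ∷ [] , rational-* rational-X rp ∷ [] , from (reg⇔ p _) refl
  sf-total (amp r) {p ∷ []} (rp ∷ []) =
    (scalar r * p) ∷ [] , rational-* (rational-scalar r) rp ∷ [] , from (amp⇔ r p _) refl
  sf-total id₀ {[]} [] = [] , [] , tt
  sf-total id₁ {p ∷ []} (rp ∷ []) = p ∷ [] , rp ∷ [] , ≈ₖ-refl p
  sf-total sw {p ∷ q ∷ []} (rp ∷ rq ∷ []) = q ∷ p ∷ [] , rq ∷ rp ∷ [] , ≈ₖ-refl p , ≈ₖ-refl q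
  sf-total (seq c d) ru with sf-total c ru
  ... | w , rw , x with sf-total d rw
  ... | v , rv , y = v , rv , w , x , y
  sf-total (par {n₁ = n₁} {c = c} {d = d} sc sd) ru
    with sf-total sc (All.take⁺ n₁ ru) | sf-total sd (All.drop⁺ n₁ ru)
  ... | v , rv , x | w , rw , y = v ++ w , All.++⁺ rv rw ,
    ⟦⟧-respects c ≋ᵛ-refl (≡⇒≋ᵛ (≡.sym (take-++ v w))) x ,
    ⟦⟧-respects d ≋ᵛ-refl (≡⇒≋ᵛ (≡.sym (drop-++ v w))) y
  sf-total (tr {c = c} sc) {u} ru
    -- Runs with feedback inputs 0 and 1 suffice: adding `z` times their difference to the first
    -- gives a run with feedback input `z`, whose output head is `s + z d` with `d = t - s`.
    with sf-total sc {0# ∷ u} (rational-0 ∷ ru) | sf-total sc {1# ∷ u} (rational-1 ∷ ru)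
  ... | s ∷ v₀ , rs ∷ rv₀ , x₀ | t ∷ v₁ , rt ∷ rv₁ , x₁ = result
    where
    r-1 : Rational (- 1#)
    r-1 = rational-neg rational-1

    result : ∃[ v ] (All Rational v × ⟦ Tr c ⟧ u v)
    result with rational-feedback rs (rational-+ (rational-* r-1 rs) rt)
    ... | z , rz , Xe≈z = _ , comb-rational rz (comb-rational r-1 rv₀ rv₁) rv₀ ,
      Tr-from c
        (⟦⟧-respects c (head≈z ∷ comb-difference z u) ≋ᵛ-refl
          (sf-linear sc z (sf-linear sc (- 1#) x₀ x₁) x₀))
        (trans (*-congˡ (+-comm _ s)) Xe≈z)
      where
      head≈z : z * ((- 1#) * 0# + 1#) + 0# ≈ z
      head≈z = trans (+-identityʳ _) (trans (*-congˡ
        (trans (+-congʳ (zeroʳ (- 1#))) (+-identityˡ 1#))) (*-identityʳ z))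

  sf⇒asf : ∀ {n m} {e : ACirc n m} → SF e → ASF e
  sf⇒asf copy = copy
  sf⇒asf disc = disc
  sf⇒asf add = add
  sf⇒asf zer = zer
  sf⇒asf reg = reg
  sf⇒asf (amp r) = amp r
  sf⇒asf id₀ = id₀
  sf⇒asf id₁ = id₁
  sf⇒asf sw = sw
  sf⇒asf (seq c d) = seq (sf⇒asf c) (sf⇒asf d)
  sf⇒asf (par c d) = par (sf⇒asf c) (sf⇒asf d)
  sf⇒asf (tr c) = tr (sf⇒asf c)

  -- Homogenisation: occurrences of `1` become branches of one input wire.

  idₙ-sf : ∀ {b} n → IsSF b (idₙ n)
  idₙ-sf zero    = id₀
  idₙ-sf (suc n) = par id₁ (idₙ-sf n)

  shift-sf : ∀ {b} n k → IsSF b (shift n k)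
  shift-sf zero    k = idₙ-sf (suc k)
  shift-sf (suc n) k = seq (par sw (idₙ-sf (n +ℕ k))) (par id₁ (shift-sf n k))

  -- The conclusion is phrased with `take` and `drop` to match the definition of `⊕ᴿ`, in front of
  -- which `shift` is used.
  shift-to : ∀ n k {p u w} → ⟦ shift n k ⟧ (p ∷ u) w →
    take n u ≋ᵛ take n w × p ∷ drop n u ≋ᵛ drop n w
  shift-to zero    k r = [] , id-to (suc k) r
  shift-to (suc n) k {p} {q ∷ u} {x ∷ w} (b ∷ d ∷ u′ , ((e , f) , i) , (g , r)) with shift-to n k r
  ... | t≋ , d≋ =
    trans (to (≈ₖ⇔ q b) f) (to (≈ₖ⇔ b x) g) ∷ ≋ᵛ-trans (take⁺ n u≋) t≋ ,
    ≋ᵛ-trans (to (≈ₖ⇔ p d) e ∷ drop⁺ n u≋) d≋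
    where
    u≋ : u ≋ᵛ u′
    u≋ = id-to (n +ℕ k) i

  shift-from : ∀ n k {p u w} →
    take n u ≋ᵛ take n w → p ∷ drop n u ≋ᵛ drop n w → ⟦ shift n k ⟧ (p ∷ u) w
  shift-from zero    k t≋ d≋ = id-from (suc k) d≋
  shift-from (suc n) k {p} {q ∷ u} {x ∷ w} (e ∷ t≋) d≋ =
    q ∷ p ∷ u , ((≈ₖ-refl p , ≈ₖ-refl q) , id-from (n +ℕ k) ≋ᵛ-refl) ,
    (from (≈ₖ⇔ q x) e , shift-from n k t≋ d≋)

  -- Only the slice where the new first input is 1 is constrained. The other slices are controlled
  -- by linearity of `h`, which is proved separately.
  record Homogenises {n m} (h : ACirc (suc n) m) (c : ACirc n m) : Set (a ⊔ ℓ) where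
    constructor homogenising
    field slice : ∀ u v → ⟦ c ⟧ u v ⇔ ⟦ h ⟧ (1# ∷ u) v
  open Homogenises

  homogenises-disc : ∀ {n m} (c : ACirc n m) → Homogenises (disc ⊕ c) c
  homogenises-disc c = homogenising λ u v → mk⇔ (tt ,_) proj₂

  homogenises-one : Homogenises id₁ one
  homogenises-one = homogenising λ { [] (p ∷ []) → mk⇔
    (λ e → from (≈ₖ⇔ 1# p) (to (one⇔ p) e))
    (λ e → from (one⇔ p) (to (≈ₖ⇔ 1# p) e)) }

  module _ {n j m} {c : ACirc n j} {d : ACirc j m} where

    -- The one-sided rules follow the clauses of `hat`: a single occurrence of `1` lies in one
    -- factor, and the wire leads there without being copied.
    homogenises-⨾ˡ : ∀ {h} → Homogenises h c → Homogenises (h ⨾ d) (c ⨾ d)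
    homogenises-⨾ˡ hc = homogenising λ u v → mk⇔
      (λ (w , x , y) → w , to (slice hc u w) x , y)
      (λ (w , x , y) → w , from (slice hc u w) x , y)

    homogenises-⨾ʳ : ∀ {h} → Homogenises h d → Homogenises ((id₁ ⊕ c) ⨾ h) (c ⨾ d)
    homogenises-⨾ʳ {h} hd = homogenising λ u v → mk⇔
      (λ (w , x , y) → 1# ∷ w , (≈ₖ-refl 1# , x) , to (slice hd w v) y)
      (λ { (p ∷ w , (e , x) , y) → w , x ,
        from (slice hd w v) (⟦⟧-respects h (sym (to (≈ₖ⇔ 1# p) e) ∷ ≋ᵛ-refl) ≋ᵛ-refl y) })

    -- Both factors may contain `1`, so the wire is copied: one branch feeds `h`, the other bypasses
    -- it and feeds `h′`.
    homogenises-⨾ : ∀ {h h′} → Homogenises h c → Homogenises h′ d →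
      Homogenises ((copy ⊕ idₙ n) ⨾ (id₁ ⊕ h) ⨾ h′) (c ⨾ d)
    homogenises-⨾ {h} {h′} hc hd = homogenising λ u v → mk⇔
      (λ (w , x , y) → 1# ∷ w ,
        (1# ∷ 1# ∷ u , ((≈ₖ-refl 1# , ≈ₖ-refl 1#) , id-from n ≋ᵛ-refl) , (≈ₖ-refl 1# , to (slice hc u w) x)) ,
        to (slice hd w v) y)
      (λ { (r ∷ w , (p ∷ q ∷ u′ , ((e , f) , i) , (g , x)) , y) → w ,
        from (slice hc u w) (⟦⟧-respects h
          (sym (to (≈ₖ⇔ 1# q) f) ∷ ≋ᵛ-sym (id-to n i)) ≋ᵛ-refl x) ,
        from (slice hd w v) (⟦⟧-respects h′
          (sym (trans (to (≈ₖ⇔ 1# p) e) (to (≈ₖ⇔ p r) g)) ∷ ≋ᵛ-refl) ≋ᵛ-refl y) })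

  module _ {n₁ m₁ n₂ m₂} {c : ACirc n₁ m₁} {d : ACirc n₂ m₂} where

    homogenises-⊕ˡ : ∀ {h} → Homogenises h c → Homogenises (h ⊕ d) (c ⊕ d)
    homogenises-⊕ˡ hc = homogenising λ u v → mk⇔
      (λ (x , y) → to (slice hc _ _) x , y)
      (λ (x , y) → from (slice hc _ _) x , y)

    private
      -- The values between `shift` and the product, with the new wire just before the inputs of the
      -- second factor.
      insert : Vec Kx (n₁ +ℕ n₂) → Vec Kx (n₁ +ℕ suc n₂)
      insert u = take n₁ u ++ 1# ∷ drop n₁ u

      take-insert : ∀ u → take n₁ u ≋ᵛ take n₁ (insert u)
      take-insert u = ≡⇒≋ᵛ (≡.sym (take-++ (take n₁ u) _))

      drop-insert : ∀ u → 1# ∷ drop n₁ u ≋ᵛ drop n₁ (insert u)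
      drop-insert u = ≡⇒≋ᵛ (≡.sym (drop-++ (take n₁ u) _))

    homogenises-⊕ʳ : ∀ {h} → Homogenises h d → Homogenises (shift n₁ n₂ ⨾ (c ⊕ h)) (c ⊕ d)
    homogenises-⊕ʳ {h} hd = homogenising λ u v → mk⇔
      (λ (x , y) → insert u ,
        shift-from n₁ n₂ (take-insert u) (drop-insert u) ,
        ⟦⟧-respects c (take-insert u) ≋ᵛ-refl x ,
        ⟦⟧-respects h (drop-insert u) ≋ᵛ-refl (to (slice hd _ _) y))
      (λ (w , s , x , y) → let t≋ , d≋ = shift-to n₁ n₂ s in
        ⟦⟧-respects c (≋ᵛ-sym t≋) ≋ᵛ-refl x ,
        from (slice hd _ _) (⟦⟧-respects h (≋ᵛ-sym d≋) ≋ᵛ-refl y))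

    -- One copy stays first for `h`; `shift` carries the other past the `n₁` inputs of `c` to reach
    -- `h′`.
    homogenises-⊕ : ∀ {h h′} → Homogenises h c → Homogenises h′ d →
      Homogenises ((copy ⊕ idₙ (n₁ +ℕ n₂)) ⨾ (id₁ ⊕ shift n₁ n₂) ⨾ (h ⊕ h′)) (c ⊕ d)
    homogenises-⊕ {h} {h′} hc hd = homogenising λ u v → mk⇔
      (λ (x , y) → 1# ∷ insert u ,
        (1# ∷ 1# ∷ u , ((≈ₖ-refl 1# , ≈ₖ-refl 1#) , id-from (n₁ +ℕ n₂) ≋ᵛ-refl) ,
          (≈ₖ-refl 1# , shift-from n₁ n₂ (take-insert u) (drop-insert u))) ,
        ⟦⟧-respects h (refl ∷ take-insert u) ≋ᵛ-refl (to (slice hc _ _) x) ,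
        ⟦⟧-respects h′ (drop-insert u) ≋ᵛ-refl (to (slice hd _ _) y))
      (λ { (r ∷ w , (p ∷ q ∷ u′ , ((e , f) , i) , (g , s)) , x , y) →
        let t≋ , d≋ = shift-to n₁ n₂ s
            u≋ = id-to (n₁ +ℕ n₂) i
        in
        from (slice hc _ _) (⟦⟧-respects h
          (sym (trans (to (≈ₖ⇔ 1# p) e) (to (≈ₖ⇔ p r) g)) ∷ ≋ᵛ-sym (≋ᵛ-trans (take⁺ n₁ u≋) t≋))
          ≋ᵛ-refl x) ,
        from (slice hd _ _) (⟦⟧-respects h′
          (≋ᵛ-sym (≋ᵛ-trans (to (≈ₖ⇔ 1# q) f ∷ drop⁺ n₁ u≋) d≋)) ≋ᵛ-refl y) })

  -- `Tr` closes the first port, whereas `h` expects the new wire there. The swap puts the feedback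
  -- wire first, so that the new wire stays outside the loop.
  homogenises-Tr : ∀ {n m} {c : ACirc (suc n) (suc m)} {h} → Homogenises h c →
    Homogenises (Tr ((sw ⊕ idₙ n) ⨾ h)) (Tr c)
  homogenises-Tr {n} {c = c} {h} hc = homogenising λ u v → mk⇔
    (λ x → let z , z′ , y , e = Tr-to c x in
      Tr-from ((sw ⊕ idₙ n) ⨾ h) {1# ∷ u}
        (1# ∷ z ∷ u , ((≈ₖ-refl z , ≈ₖ-refl 1#) , id-from n ≋ᵛ-refl) , to (slice hc _ _) y) e)
    (λ x → untangle u v (Tr-to ((sw ⊕ idₙ n) ⨾ h) {1# ∷ u} x))
    where
    untangle : ∀ u v → ∃[ z ] ∃[ z′ ] (⟦ (sw ⊕ idₙ n) ⨾ h ⟧ (z ∷ 1# ∷ u) (z′ ∷ v) × X * z′ ≈ z) →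
      ⟦ Tr c ⟧ u v
    untangle u v (z , z′ , (p ∷ q ∷ u′ , ((e , f) , i) , y) , Xz′≈z) = Tr-from c
      (from (slice hc _ _) (⟦⟧-respects h
        (sym (to (≈ₖ⇔ 1# p) f) ∷ sym (to (≈ₖ⇔ z q) e) ∷ ≋ᵛ-sym (id-to n i)) ≋ᵛ-refl y)) Xz′≈z

  -- The plumbing consists of copiers, discards, identities and swaps, all available in `SF`, so the
  -- result is again a signal flow graph.
  homogenise : ∀ {n m} {c : ACirc n m} → ASF c → ∃[ h ] (SF h × Homogenises h c)
  homogenise copy = _ , par disc copy , homogenises-disc copy
  homogenise disc = _ , par disc disc , homogenises-disc disc
  homogenise add = _ , par disc add , homogenises-disc add
  homogenise zer = _ , par disc zer , homogenises-disc zer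
  homogenise one = _ , id₁ , homogenises-one
  homogenise reg = _ , par disc reg , homogenises-disc reg
  homogenise (amp r) = _ , par disc (amp r) , homogenises-disc (amp r)
  homogenise id₀ = _ , par disc id₀ , homogenises-disc id₀
  homogenise id₁ = _ , par disc id₁ , homogenises-disc id₁
  homogenise sw = _ , par disc sw , homogenises-disc sw
  homogenise (seq {n = n} sc sd) with homogenise sc | homogenise sd
  ... | _ , sh , hc | _ , sh′ , hd =
    _ , seq (seq (par copy (idₙ-sf n)) (par id₁ sh)) sh′ , homogenises-⨾ hc hd
  homogenise (par {n₁ = n₁} {n₂ = n₂} sc sd) with homogenise sc | homogenise sd
  ... | _ , sh , hc | _ , sh′ , hd =
    _ , seq (seq (par copy (idₙ-sf (n₁ +ℕ n₂))) (par id₁ (shift-sf n₁ n₂))) (par sh sh′) ,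
    homogenises-⊕ hc hd
  homogenise (tr {n = n} sc) with homogenise sc
  ... | _ , sh , hc = _ , tr (seq (par sw (idₙ-sf n)) sh) , homogenises-Tr hc

-- Inserting and removing ports in partitions.

module _ {a b : ℕ} where

  -- Boundary ports and rewired ports are both sums of two finite sets, so the same map skips a port
  -- on either side of a partition.
  insertPort : Fin (suc a) → Fin a ⊎ Fin b → Fin (suc a) ⊎ Fin b
  insertPort j (inj₁ l) = inj₁ (punchIn j l)
  insertPort j (inj₂ r) = inj₂ r

  insertPort-injective : ∀ j {x y} → insertPort j x ≡ insertPort j y → x ≡ y
  insertPort-injective j {inj₁ l} {inj₁ l′} e =
    ≡.cong inj₁ (Fin.punchIn-injective j l l′ (inj₁-injective e))
  insertPort-injective j {inj₂ r} {inj₂ .r} ≡.refl = ≡.refl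

  insertPort-≢ : ∀ j x → insertPort j x ≢ inj₁ j
  insertPort-≢ j (inj₁ l) e = Fin.punchInᵢ≢i j l (inj₁-injective e)

  removePort : ∀ j x → x ≢ inj₁ j → ∃[ y ] insertPort j y ≡ x
  removePort j (inj₁ l) x≢j = inj₁ (punchOut j≢l) , ≡.cong inj₁ (Fin.punchIn-punchOut j≢l)
    where
    j≢l : j ≢ l
    j≢l j≡l = x≢j (≡.cong inj₁ (≡.sym j≡l))
  removePort j (inj₂ r) _ = inj₂ r , ≡.refl

module _ {i o n m : ℕ} where

  -- Defined for functions rather than bijections, so that one definition and one inverse law serve
  -- both directions of a partition.
  extend : (Fin i ⊎ Fin o → Fin n ⊎ Fin m) → Fin (suc i) ⊎ Fin o → Fin (suc n) ⊎ Fin m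
  extend f (inj₁ zero)    = inj₁ zero
  extend f (inj₁ (suc j)) = insertPort zero (f (inj₁ j))
  extend f (inj₂ j)       = insertPort zero (f (inj₂ j))

  extend-insertPort : ∀ f x → extend f (insertPort zero x) ≡ insertPort zero (f x)
  extend-insertPort f (inj₁ j) = ≡.refl
  extend-insertPort f (inj₂ j) = ≡.refl

extend-inverse : ∀ {i o n m} (f : Fin i ⊎ Fin o → Fin n ⊎ Fin m) g → (∀ x → f (g x) ≡ x) →
  ∀ x → extend f (extend g x) ≡ x
extend-inverse f g fg≡ (inj₁ zero)    = ≡.refl
extend-inverse f g fg≡ (inj₁ (suc j)) =
  ≡.trans (extend-insertPort f (g (inj₁ j))) (≡.cong (insertPort zero) (fg≡ (inj₁ j)))
extend-inverse f g fg≡ (inj₂ j)       =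
  ≡.trans (extend-insertPort f (g (inj₂ j))) (≡.cong (insertPort zero) (fg≡ (inj₂ j)))

-- Input ports and realisability.

module Input {a ℓ} (k : Field a ℓ) where
  open Theory k
  open RationalFunctions k
  open Circuits k
  open Realisability k
  open CommutativeRing K hiding (zero)
  open Equivalence using (to; from)

  private
    sum-is-1 : ∀ p q → p +ℕ q ≡ 1 → (p ≡ 1 × q ≡ 0) ⊎ (p ≡ 0 × q ≡ 1)
    sum-is-1 0 q e = inj₂ (≡.refl , e)
    sum-is-1 1 q e = inj₁ (≡.refl , ℕ.suc-injective e)

    sum-is-0 : ∀ p {q} → p +ℕ q ≡ 0 → p ≡ 0 × q ≡ 0
    sum-is-0 p e = ℕ.m+n≡0⇒m≡0 p e , ℕ.m+n≡0⇒n≡0 p e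

  has1-true : ∀ {n m} (c : ACirc n m) → #one c ≡ 1 → has1 c ≡ true
  has1-true c e rewrite e = ≡.refl

  has1-false : ∀ {n m} (c : ACirc n m) → #one c ≡ 0 → has1 c ≡ false
  has1-false c e rewrite e = ≡.refl

  -- The count decides which factor holds the occurrence of `1`, and thereby evaluates the test on
  -- which `hat` branches.
  hat-homogenises : ∀ {n m} (c : ACirc n m) → #one c ≡ 1 → Homogenises (hat c) c
  hat-homogenises one _ = homogenises-one
  hat-homogenises (c ⨾ d) e with sum-is-1 (#one c) (#one d) e
  ... | inj₁ (e′ , _) rewrite has1-true c e′ = homogenises-⨾ˡ (hat-homogenises c e′)
  ... | inj₂ (e₀ , e′) rewrite has1-false c e₀ = homogenises-⨾ʳ (hat-homogenises d e′)
  hat-homogenises (c ⊕ d) e with sum-is-1 (#one c) (#one d) e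
  ... | inj₁ (e′ , _) rewrite has1-true c e′ = homogenises-⊕ˡ (hat-homogenises c e′)
  ... | inj₂ (e₀ , e′) rewrite has1-false c e₀ = homogenises-⊕ʳ (hat-homogenises d e′)

  counts⇒oneFree : ∀ {n m} (c : ACirc n m) → #one c ≡ 0 → #oneᵒᵖ c ≡ 0 → OneFree c
  counts⇒oneFree copy _ _ = tt
  counts⇒oneFree disc _ _ = tt
  counts⇒oneFree add _ _ = tt
  counts⇒oneFree zer _ _ = tt
  counts⇒oneFree reg _ _ = tt
  counts⇒oneFree (amp r) _ _ = tt
  counts⇒oneFree copyᵒᵖ _ _ = tt
  counts⇒oneFree discᵒᵖ _ _ = tt
  counts⇒oneFree addᵒᵖ _ _ = tt
  counts⇒oneFree zerᵒᵖ _ _ = tt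
  counts⇒oneFree regᵒᵖ _ _ = tt
  counts⇒oneFree (ampᵒᵖ r) _ _ = tt
  counts⇒oneFree id₀ _ _ = tt
  counts⇒oneFree id₁ _ _ = tt
  counts⇒oneFree sw _ _ = tt
  counts⇒oneFree (c ⨾ d) e f =
    let e₁ , e₂ = sum-is-0 (#one c) e ; f₁ , f₂ = sum-is-0 (#oneᵒᵖ c) f
    in counts⇒oneFree c e₁ f₁ , counts⇒oneFree d e₂ f₂
  counts⇒oneFree (c ⊕ d) e f =
    let e₁ , e₂ = sum-is-0 (#one c) e ; f₁ , f₂ = sum-is-0 (#oneᵒᵖ c) f
    in counts⇒oneFree c e₁ f₁ , counts⇒oneFree d e₂ f₂

  hat-oneFree : ∀ {n m} (c : ACirc n m) → #one c ≡ 1 → #oneᵒᵖ c ≡ 0 → OneFree (hat c)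
  hat-oneFree one _ _ = tt
  hat-oneFree (c ⨾ d) e f with sum-is-1 (#one c) (#one d) e | sum-is-0 (#oneᵒᵖ c) f
  ... | inj₁ (e′ , e₀) | f₁ , f₂ rewrite has1-true c e′ =
    hat-oneFree c e′ f₁ , counts⇒oneFree d e₀ f₂
  ... | inj₂ (e₀ , e′) | f₁ , f₂ rewrite has1-false c e₀ =
    (tt , counts⇒oneFree c e₀ f₁) , hat-oneFree d e′ f₂
  hat-oneFree (_⊕_ {n₁} {n₂ = n₂} c d) e f with sum-is-1 (#one c) (#one d) e | sum-is-0 (#oneᵒᵖ c) f
  ... | inj₁ (e′ , e₀) | f₁ , f₂ rewrite has1-true c e′ =
    hat-oneFree c e′ f₁ , counts⇒oneFree d e₀ f₂
  ... | inj₂ (e₀ , e′) | f₁ , f₂ rewrite has1-false c e₀ =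
    sf⇒oneFree (shift-sf n₁ n₂) , counts⇒oneFree c e₀ f₁ , hat-oneFree d e′ f₂

  -- The position is arbitrary because a partition may list the new port anywhere among its inputs.
  insertOne : ∀ {n} → Fin (suc n) → ACirc n (suc n)
  insertOne {n}     zero    = one ⊕ idₙ n
  insertOne {suc n} (suc j) = id₁ ⊕ insertOne j

  insertOne-asf : ∀ {n} j → ASF (insertOne {n} j)
  insertOne-asf {n}     zero    = par one (idₙ-sf n)
  insertOne-asf {suc n} (suc j) = par id₁ (insertOne-asf j)

  insertOne-to : ∀ {n} j {u w} → ⟦ insertOne {n} j ⟧ u w → insertAt u j 1# ≋ᵛ w
  insertOne-to {n}     zero    {u} {p ∷ w}         (e , i) = to (one⇔ p) e ∷ id-to n i
  insertOne-to {suc n} (suc j) {p ∷ u} {q ∷ w} (e , r) = to (≈ₖ⇔ p q) e ∷ insertOne-to j r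

  insertOne-from : ∀ {n} j {u} → ⟦ insertOne {n} j ⟧ u (insertAt u j 1#)
  insertOne-from {n}     zero            = from (one⇔ 1#) refl , id-from n ≋ᵛ-refl
  insertOne-from {suc n} (suc j) {p ∷ u} = ≈ₖ-refl p , insertOne-from j

  rewire-respects : ∀ {n m i o} (c : ACirc n m) (σ : Partition n m i o) → Respects (rewire c σ)
  rewire-respects c σ {x} {x′} {y} {y′} x≋ y≋ (u , v , r , hx , hy) = u , v , r ,
    (λ j → move (at u v (Inverse.to σ (inj₁ j))) (Pointwise.lookup x≋ j) (hx j)) ,
    (λ j → move (at u v (Inverse.to σ (inj₂ j))) (Pointwise.lookup y≋ j) (hy j))
    where
    move : ∀ {p p′} q → p ≈ p′ → ↑ (p ≈ₖ q) → ↑ (p′ ≈ₖ q)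
    move {p} {p′} q e f = from (≈ₖ⇔ p′ q) (trans (sym e) (to (≈ₖ⇔ p q) f))

  lookup-comb : ∀ s {n} (u v : Vec Kx n) j →
    lookup (comb s u v) j ≡ s * lookup u j + lookup v j
  lookup-comb s u v j = Vec.lookup-zipWith _ j u v

  at-comb : ∀ s {n m} (u u′ : Vec Kx n) (v v′ : Vec Kx m) x →
    at (comb s u u′) (comb s v v′) x ≡ s * at u v x + at u′ v′ x
  at-comb s u u′ v v′ (inj₁ j) = lookup-comb s u u′ j
  at-comb s u u′ v v′ (inj₂ j) = lookup-comb s v v′ j

  -- Rewiring merely regroups coordinates, and reading off a port commutes with `comb`.
  rewire-linear : ∀ {n m i o} (c : ACirc n m) (σ : Partition n m i o) →
    Linear ⟦ c ⟧ → Linear (rewire c σ)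
  rewire-linear c σ c-lin s {x} {x′} {y} {y′} (u , v , r , hx , hy) (u′ , v′ , r′ , hx′ , hy′) =
    comb s u u′ , comb s v v′ , c-lin s r r′ ,
    (λ j → wire x x′ j (Inverse.to σ (inj₁ j)) (hx j) (hx′ j)) , (λ j → wire y y′ j (Inverse.to σ (inj₂ j)) (hy j) (hy′ j))
    where
    wire : ∀ {l} (z z′ : Vec Kx l) j x →
      ↑ (lookup z j ≈ₖ at u v x) → ↑ (lookup z′ j ≈ₖ at u′ v′ x) →
      ↑ (lookup (comb s z z′) j ≈ₖ at (comb s u u′) (comb s v v′) x)
    wire z z′ j x e e′ rewrite lookup-comb s z z′ j | at-comb s u u′ v v′ x =
      from (≈ₖ⇔ _ _) (+-cong (*-congˡ (to (≈ₖ⇔ (lookup z j) (at u v x)) e))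
                             (to (≈ₖ⇔ (lookup z′ j) (at u′ v′ x)) e′))

  at-insertPort : ∀ {n m} p (u : Vec Kx n) (v : Vec Kx m) x →
    at (p ∷ u) v (insertPort zero x) ≡ at u v x
  at-insertPort p u v (inj₁ j) = ≡.refl
  at-insertPort p u v (inj₂ j) = ≡.refl

  extendPartition : ∀ {n m i o} → Partition n m i o → Partition (suc n) m (suc i) o
  extendPartition σ = mk↔ₛ′ (extend (Inverse.to σ)) (extend (Inverse.from σ))
    (extend-inverse _ _ (Inverse.strictlyInverseˡ σ))
    (extend-inverse _ _ (Inverse.strictlyInverseʳ σ))

  -- The circuit `hat c′` is generalised to any `h` that homogenises `c′`; how the occurrence of `1`
  -- was removed no longer matters.
  module _ {n m} (c c′ : ACirc n m) (c′≐c : ⟦ c′ ⟧ ≐ ⟦ c ⟧) {h : ACirc (suc n) m}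
    (hc : Homogenises h c′) where

    slice-to : ∀ {u v} → ⟦ c ⟧ u v → ⟦ h ⟧ (1# ∷ u) v
    slice-to {u} {v} r = to (Homogenises.slice hc u v) (proj₂ (c′≐c u v) r)

    slice-from : ∀ {p u v} → p ≈ 1# → ⟦ h ⟧ (p ∷ u) v → ⟦ c ⟧ u v
    slice-from {p} {u} {v} p≈1 r = proj₁ (c′≐c u v)
      (from (Homogenises.slice hc u v) (⟦⟧-respects h (p≈1 ∷ ≋ᵛ-refl) ≋ᵛ-refl r))

    -- The new port becomes input 0, where the rewiring condition fixes its value to 1; rewiring
    -- therefore commutes with taking the slice.
    rewire-extend : ∀ {i o} (σ : Partition n m i o) u v →
      rewire c σ u v ⇔ rewire h (extendPartition σ) (1# ∷ u) v
    rewire-extend σ x y = mk⇔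
      (λ (u , v , r , hx , hy) → 1# ∷ u , v , slice-to r ,
        (λ { zero → ≈ₖ-refl 1#
           ; (suc j) → ≡.subst (λ q → ↑ (lookup x j ≈ₖ q))
               (≡.sym (at-insertPort 1# u v (Inverse.to σ (inj₁ j)))) (hx j) }) ,
        (λ j → ≡.subst (λ q → ↑ (lookup y j ≈ₖ q))
               (≡.sym (at-insertPort 1# u v (Inverse.to σ (inj₂ j)))) (hy j)))
      (λ { (p ∷ u , v , r , hx , hy) → u , v ,
        slice-from (sym (to (≈ₖ⇔ 1# p) (hx zero))) r ,
        (λ j → ≡.subst (λ q → ↑ (lookup x j ≈ₖ q))
               (at-insertPort p u v (Inverse.to σ (inj₁ j))) (hx (suc j))) ,
        (λ j → ≡.subst (λ q → ↑ (lookup y j ≈ₖ q))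
               (at-insertPort p u v (Inverse.to σ (inj₂ j))) (hy j)) })

    realisable⇒input : Linear ⟦ h ⟧ → Realisable c → IsInputPort h (inj₁ zero)
    realisable⇒input h-lin (i , o , σ , e , e-asf , e≐) with homogenise e-asf
    -- The input `(1, 0, ..., 0)` is rational, so totality yields the point in the slice that
    -- `slice-≐` needs.
    ... | e′ , e′-sf , he with sf-total e′-sf {1# ∷ replicate i 0#}
                                 (rational-1 ∷ All.lookup⁻ (λ j →
                                   ≡.subst Rational (≡.sym (Vec.lookup-replicate j 0#)) rational-0))
    ... | _ , _ , r₀ = suc i , o , extendPartition σ , (zero , ≡.refl) , e′ , e′-sf ,
      slice-≐ (sf-linear e′-sf) (rewire-linear h (extendPartition σ) h-lin)
        (⟦⟧-respects e′) (rewire-respects h (extendPartition σ))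
        (λ u v → mk⇔
          (λ r → to (rewire-extend σ u v) (proj₁ (e≐ u v) (from (Homogenises.slice he u v) r)))
          (λ r → to (Homogenises.slice he u v) (proj₂ (e≐ u v) (from (rewire-extend σ u v) r))))
        r₀

    module _ {i o} (σ : Partition (suc n) m (suc i) o) (j : Fin (suc i))
      (σj≡0 : Inverse.to σ (inj₁ j) ≡ inj₁ zero) where

      private
        module σ = Inverse σ

        -- Since `σ` is injective and sends input `j` to the new port, every other rewired port goes
        -- to an old boundary port.
        to-remove : ∀ x → ∃[ y ] insertPort zero y ≡ σ.to (insertPort j x)
        to-remove x = removePort zero (σ.to (insertPort j x)) λ e →
          insertPort-≢ j x (≡.trans (≡.sym (σ.strictlyInverseʳ _))
            (≡.trans (≡.cong σ.from (≡.trans e (≡.sym σj≡0))) (σ.strictlyInverseʳ _)))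

        from-remove : ∀ y → ∃[ x ] insertPort j x ≡ σ.from (insertPort zero y)
        from-remove y = removePort j (σ.from (insertPort zero y)) λ e →
          insertPort-≢ zero y (≡.trans (≡.sym (σ.strictlyInverseˡ _))
            (≡.trans (≡.cong σ.to e) σj≡0))

        τ : Fin i ⊎ Fin o → Port n m
        τ x = proj₁ (to-remove x)

        τ⁻¹ : Port n m → Fin i ⊎ Fin o
        τ⁻¹ y = proj₁ (from-remove y)

        τ-τ⁻¹ : ∀ y → τ (τ⁻¹ y) ≡ y
        τ-τ⁻¹ y = insertPort-injective zero (≡.trans (proj₂ (to-remove (τ⁻¹ y)))
          (≡.trans (≡.cong σ.to (proj₂ (from-remove y))) (σ.strictlyInverseˡ _)))

        τ⁻¹-τ : ∀ x → τ⁻¹ (τ x) ≡ x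
        τ⁻¹-τ x = insertPort-injective j (≡.trans (proj₂ (from-remove (τ x)))
          (≡.trans (≡.cong σ.from (proj₂ (to-remove x))) (σ.strictlyInverseʳ _)))

        at-τ : ∀ p (u : Vec Kx n) (v : Vec Kx m) x → at (p ∷ u) v (σ.to (insertPort j x)) ≡ at u v (τ x)
        at-τ p u v x = ≡.trans (≡.cong (at (p ∷ u) v) (≡.sym (proj₂ (to-remove x))))
          (at-insertPort p u v (τ x))

      removePartition : Partition n m i o
      removePartition = mk↔ₛ′ τ τ⁻¹ τ-τ⁻¹ τ⁻¹-τ

      rewire-remove : ∀ x y →
        rewire c removePartition x y ⇔ rewire h σ (insertAt x j 1#) y
      rewire-remove x y = mk⇔ forward backward
        where
        forward : rewire c removePartition x y → rewire h σ (insertAt x j 1#) y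
        forward (u , v , r , hx , hy) = 1# ∷ u , v , slice-to r , hx′ ,
          λ l → ≡.subst (λ q → ↑ (lookup y l ≈ₖ q)) (≡.sym (at-τ 1# u v (inj₂ l))) (hy l)
          where
          hx′ : ∀ l → ↑ (lookup (insertAt x j 1#) l ≈ₖ at (1# ∷ u) v (σ.to (inj₁ l)))
          -- Input `j` carries the inserted 1 and meets the new port; any other input is an old one,
          -- renumbered by `punchOut`.
          hx′ l with j ≟ l
          ... | yes ≡.refl = ≡.subst₂ (λ p x → ↑ (p ≈ₖ at (1# ∷ u) v x))
            (≡.sym (Vec.insertAt-lookup x j 1#)) (≡.sym σj≡0) (≈ₖ-refl 1#)
          ... | no j≢l = ≡.subst
            (λ l → ↑ (lookup (insertAt x j 1#) l ≈ₖ at (1# ∷ u) v (σ.to (inj₁ l))))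
            (Fin.punchIn-punchOut j≢l)
            (≡.subst₂ (λ p q → ↑ (p ≈ₖ q))
              (≡.sym (Vec.insertAt-punchIn x j 1# (punchOut j≢l)))
              (≡.sym (at-τ 1# u v (inj₁ (punchOut j≢l))))
              (hx (punchOut j≢l)))

        backward : rewire h σ (insertAt x j 1#) y → rewire c removePartition x y
        backward (p ∷ u , v , r , hx , hy) = u , v , slice-from (sym (to (≈ₖ⇔ 1# p) 1≈p)) r ,
          (λ l → ≡.subst₂ (λ p q → ↑ (p ≈ₖ q))
            (Vec.insertAt-punchIn x j 1# l) (at-τ p u v (inj₁ l)) (hx (punchIn j l))) ,
          (λ l → ≡.subst (λ q → ↑ (lookup y l ≈ₖ q)) (at-τ p u v (inj₂ l)) (hy l))
          where
          1≈p : ↑ (1# ≈ₖ p)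
          1≈p = ≡.subst₂ (λ q x → ↑ (q ≈ₖ at (p ∷ u) v x)) (Vec.insertAt-lookup x j 1#) σj≡0 (hx j)

      insertOne-realises : ∀ (e : ACirc (suc i) o) → ⟦ e ⟧ ≐ rewire h σ →
        ⟦ insertOne j ⨾ e ⟧ ≐ rewire c removePartition
      insertOne-realises e e≐ x y =
        (λ (w , s , r) → from (rewire-remove x y) (proj₁ (e≐ _ y)
          (⟦⟧-respects e (≋ᵛ-sym (insertOne-to j s)) ≋ᵛ-refl r))) ,
        (λ r → insertAt x j 1# , insertOne-from j , proj₂ (e≐ _ y) (to (rewire-remove x y) r))

    input⇒realisable : IsInputPort h (inj₁ zero) → Realisable c
    -- The input `j` rules out a partition without inputs, so the pattern `suc i` is exhaustive.
    input⇒realisable (suc i , o , σ , (j , σj≡0) , e , e-sf , e≐) =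
      i , o , removePartition σ j σj≡0 , insertOne j ⨾ e ,
      seq (insertOne-asf j) (sf⇒asf e-sf) , insertOne-realises σ j σj≡0 e e≐

theorem6 : ∀ {a ℓ} (k : Field a ℓ) → let open Theory k in
    ∀ {n m} (c c' : ACirc n m) →
    ⟦ c' ⟧ ≐ ⟦ c ⟧ → #one c' ≡ 1 → #oneᵒᵖ c' ≡ 0 →
    (Realisable c → IsInputPort (hat c') (inj₁ zero))
    × (IsInputPort (hat c') (inj₁ zero) → Realisable c)
theorem6 k c c' c'≐c one-1 oneᵒᵖ-0 =
  realisable⇒input c c' c'≐c homogenises (⟦⟧-linear (hat c') (hat-oneFree c' one-1 oneᵒᵖ-0)) ,
  input⇒realisable c c' c'≐c homogenises
  where
  open Theory k
  open Circuits k
  open Realisability k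
  open Input k

  homogenises : Homogenises (hat c') c'
  homogenises = hat-homogenises c' one-1
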